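{- For every formal weight enumerator $W(x,y)=x^n+\sum_{i=d}^n A_i x^{n-i} y^i$ (with $A_d\ne 0$) of Types I through IV, we have: (Type I) $d\leq 2\left[ \frac{n-4}{8} \right] +2$; (Type II) $d\leq 4\left[ \frac{n-12}{24} \right] +4$; (Type III) $d\leq 3\left[ \frac{n-6}{12} \right] +3$; (Type IV) $d\leq 2\left[ \frac{n-3}{6} \right] +2$, where $[x]$ denotes the greatest integer not exceeding $x\in\mathbf{R}$.
   Context: Consider homogeneous polynomials of the form $W(x,y)=x^n+\sum_{i=d}^n A_i x^{n-i} y^i\in \mathbf{C}[x,y]$ with $A_d\ne 0$. For a linear transformation $\sigma=\begin{pmatrix} a & b \\ c & d\end{pmatrix}$, set $W^\sigma(x,y)=W(ax+by,cx+dy)$. The MacWilliams transform is $\sigma_q=\frac{1}{\sqrt{q}}\begin{pmatrix} 1 & q-1 \\ 1 & -1\end{pmatrix}$; $W$ is called a formal weight enumerator for $q$ if $W^{\sigma_q}(x,y)=-W(x,y)$. $W$ is divisible by $c$ if $A_i\ne 0$ implies $c\mid i$. Let $W_{2,q}(x,y)=x^2+(q-1)y^2$, $\varphi_4(x,y)=x^4-6x^2y^2+y^4$, $W_{\mathcal{H}_8}(x,y)=x^8+14x^4y^4+y^8$, $W_{12}(x,y)=x^{12}-33x^8y^4-33x^4y^8+y^{12}$, $W_4(x,y)=x^4+8xy^3$, $\psi_6(x,y)=x^6-20x^3y^3-8y^6$, $\varphi_3(x,y)=x^3-9xy^2$. Type I formal weight enumerators are the formal weight enumerators (for $q=2$)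 in the ring $\mathbf{C}[W_{2,2}(x,y),\varphi_4(x,y)]$; Type II are the formal weight enumerators (for $q=2$) in $\mathbf{C}[W_{\mathcal{H}_8}(x,y),W_{12}(x,y)]$; Type III are the formal weight enumerators (for $q=3$) in $\mathbf{C}[W_4(x,y),\psi_6(x,y)]$; Type IV are the formal weight enumerators (for $q=4$) in $\mathbf{C}[W_{2,4}(x,y),\varphi_3(x,y)]$. -}

module Defs where

open import Level using (Level; _⊔_) renaming (suc to lsuc)
open import Algebra.Bundles using (CommutativeRing)
open import Data.Nat as ℕ using (ℕ; zero; suc; _∸_)
open import Data.Integer as ℤ using (ℤ; +_)
open import Data.Integer.DivMod using (_/ℕ_)
open import Data.Product using (∃; _×_; _,_)
open import Relation.Nullary using (¬_)

module RingHelpers {c ℓ} (R : CommutativeRing c ℓ) where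
  open CommutativeRing R

  pow : Carrier → ℕ → Carrier
  pow x zero    = 1#
  pow x (suc n) = x * pow x n

  cast : ℕ → Carrier
  cast zero    = 0#
  cast (suc n) = 1# + cast n

  sumTo : ℕ → (ℕ → Carrier) → Carrier
  sumTo zero    f = 0#
  sumTo (suc n) f = sumTo n f + f n

-- The field of complex numbers is not available in Agda; we axiomatise
-- "an algebraically closed field of characteristic 0" (the first-order
-- properties of C) and state the theorem for every such field.

record AlgClosedFieldChar0 c ℓ : Set (lsuc (c ⊔ ℓ)) where
  field
    commRing : CommutativeRing c ℓ
  open CommutativeRing commRing public
  open RingHelpers commRing public
  field
    nontrivial : ¬ (1# ≈ 0#)
    inverse    : ∀ x → ¬ (x ≈ 0#) → ∃ λ y → x * y ≈ 1#
    char0      : ∀ n → ¬ (cast (suc n) ≈ 0#)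
    algClosed  : ∀ (n : ℕ) (a : ℕ → Carrier) →
                 ∃ λ z → pow z (suc n) + sumTo (suc n) (λ i → a i * pow z i) ≈ 0#

-- Homogeneous binary forms, viewed as (polynomial) functions K → K → K.
-- Over an infinite field equality of polynomial functions is equality of
-- polynomials.

module Forms {c ℓ} (K : AlgClosedFieldChar0 c ℓ) where
  open AlgClosedFieldChar0 K

  BinForm : Set c
  BinForm = Carrier → Carrier → Carrier

  form : ℕ → (ℕ → Carrier) → BinForm
  form n A x y = pow x n + sumTo n (λ j → A (suc j) * pow x (n ∸ suc j) * pow y (suc j))

  transform : Carrier → Carrier → Carrier → Carrier → BinForm → BinForm
  transform a b c' d W x y = W (a * x + b * y) (c' * x + d * y)

  -- r plays the role of 1/√q (any r with q r^2 = 1).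
  -- σ_q = r (1 q-1 ; 1 -1);  W is a formal weight enumerator for q
  IsFormalWE : ℕ → Carrier → BinForm → Set (c ⊔ ℓ)
  IsFormalWE q r W = ∀ x y →
    transform r (r * cast (q ∸ 1)) r (- r) W x y ≈ - (W x y)

  InRing : BinForm → BinForm → BinForm → Set (c ⊔ ℓ)
  InRing f g W = ∃ λ (N : ℕ) → ∃ λ (coef : ℕ → ℕ → Carrier) → ∀ x y →
    W x y ≈ sumTo N (λ a → sumTo N (λ b → coef a b * pow (f x y) a * pow (g x y) b))

  W2 : ℕ → BinForm
  W2 q x y = pow x 2 + cast (q ∸ 1) * pow y 2

  φ4 : BinForm
  φ4 x y = pow x 4 - cast 6 * pow x 2 * pow y 2 + pow y 4

  WH8 : BinForm
  WH8 x y = pow x 8 + cast 14 * pow x 4 * pow y 4 + pow y 8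

  W12 : BinForm
  W12 x y = pow x 12 - cast 33 * pow x 8 * pow y 4 - cast 33 * pow x 4 * pow y 8 + pow y 12

  W4 : BinForm
  W4 x y = pow x 4 + cast 8 * x * pow y 3

  ψ6 : BinForm
  ψ6 x y = pow x 6 - cast 20 * pow x 3 * pow y 3 - cast 8 * pow y 6

  φ3 : BinForm
  φ3 x y = pow x 3 - cast 9 * x * pow y 2

  -- The bound: for every formal weight enumerator for q in K[f,g] of the form
  -- x^n + Σ_{i=d}^n A_i x^(n-i) y^i with A_d ≠ 0 (1 ≤ d ≤ n),
  --   d ≤ k ⌊(n - s)/m⌋ + k      (⌊_⌋ = floor; _/ℕ_ is floor division for m > 0)
  MinDistBound : (q : ℕ) → BinForm → BinForm → (k s m : ℕ) → .{{_ : ℕ.NonZero m}} → Set (c ⊔ ℓ)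
  MinDistBound q f g k s m =
    ∀ (r : Carrier) → cast q * (r * r) ≈ 1# →
    ∀ (n d : ℕ) (A : ℕ → Carrier) →
    1 ℕ.≤ d → d ℕ.≤ n →
    (∀ i → 1 ℕ.≤ i → i ℕ.< d → A i ≈ 0#) →
    ¬ (A d ≈ 0#) →
    IsFormalWE q r (form n A) →
    InRing f g (form n A) →
    + d ℤ.≤ (+ k) ℤ.* (((+ n) ℤ.- (+ s)) /ℕ m) ℤ.+ (+ k)

{-# OPTIONS --safe #-}

-- Let f, g be the two generators, of degrees α and β with pα = 2β.  As polynomials in
-- U = yᵏ, F = f(1, y) and G = g(1, y) satisfy Fᵖ = G² + C U (1 − U)ᵛ in all four types,
-- and t = U (1 − U)ᵛ / Fᵖ has logarithmic derivative y t′/t = k G / (F (1 − U)).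
-- The MacWilliams transform fixes f and negates g, so only odd powers of g occur in a
-- formal weight enumerator W of degree n = β + 2βμ + ρ (0 ≤ ρ < 2β): with e = ρ/α,
--   W(1, y) = Σ_{b ≤ μ} c_b F^{e + p(μ−b)} G^{2b+1}.
-- Multiplication by M = F^{p−1−e} (1 − U)^{−v(μ+1)−1} turns this into U^{μ+1} y t′/t times a
-- combination of t⁻¹, …, t^{−μ−1}.  The residue of an exact differential is zero, hence
-- so is the coefficient of M W at U^{μ+1}.  But if d > k(μ + 1), this is the coefficient
-- of M itself, a positive integer.
module Submission where

open import Defs
open import Level using (_⊔_)
open import Algebra.Bundles using (CommutativeRing)
open import Algebra.Structures using (IsCommutativeRing)
import Algebra.Properties.AbelianGroup
import Algebra.Properties.Ring
import Algebra.Solver.Ring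
open import Algebra.Solver.Ring.AlmostCommutativeRing
  using (fromCommutativeRing; _-Raw-AlmostCommutative⟶_; Induced-equivalence)
open import Data.Integer as ℤ using (ℤ; +_; -[1+_]; _⊖_; _◃_)
open import Data.Integer.DivMod using (_/ℕ_)
import Data.Integer.Properties as ℤₚ
open import Data.Maybe using (just; nothing)
open import Data.Nat as ℕ using (ℕ; zero; suc; _∸_; z≤n; s≤s)
open import Data.Nat.Divisibility using (divides)
open import Data.Nat.DivMod as ℕ-div using (_%_)
import Data.Nat.Properties as ℕₚ
open import Data.Nat.Tactic.RingSolver using (solve-∀)
open import Data.Product using (∃; _×_; _,_; proj₁; proj₂)
open import Data.Sign as Sign using (Sign)
open import Data.Sum using (_⊎_; inj₁; inj₂)
open import Relation.Binary.Definitions using (WeaklyDecidable)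
import Relation.Binary.PropositionalEquality as ≡
open ≡ using (_≡_)
import Relation.Binary.Reasoning.Setoid
open import Relation.Nullary using (¬_; yes; no; contradiction)

-- Oddness in g is what makes the residue argument work. Since C t = 1 - G²/Fᵖ, the derivative of t
-- carries a factor G; each term of W has one G to give to the differential, and the even power left
-- over becomes a polynomial in t times a power of F. M is a product of powers of F and of 1/(1 -
-- U), both with nonnegative coefficients, so its positivity needs no estimate.
--
-- Three obstacles shape the rest. t⁻¹ has a pole at y = 0, so the power series E = U/t replaces it,
-- and the power of U is carried by the index of the coefficient. Forms are functions on K and the
-- given expansion in K[f, g] need not be homogeneous, so coefficients are recovered from values, in
-- y and in a scaling variable z. Finally, r may be either square root of 1/q, and for q = 4 one
-- choice fixes g instead of negating it; then no formal weight enumerator exists. Without decidable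
-- equality in K that choice is excluded only up to double negation, which suffices because the goal
-- is a decidable inequality of integers.

-- Commutative rings: integer coefficients, powers and finite sums

module RingTools {c ℓ} (R : CommutativeRing c ℓ) where
  open CommutativeRing R
  open RingHelpers R
  open Relation.Binary.Reasoning.Setoid setoid
  open Algebra.Properties.Ring ring
  open Algebra.Properties.AbelianGroup +-abelianGroup using (⁻¹-∙-comm)

  cast-+ : ∀ m n → cast (m ℕ.+ n) ≈ cast m + cast n
  cast-+ zero    n = sym (+-identityˡ _)
  cast-+ (suc m) n = trans (+-congˡ (cast-+ m n)) (sym (+-assoc _ _ _))

  cast-* : ∀ m n → cast (m ℕ.* n) ≈ cast m * cast n
  cast-* zero    n = sym (zeroˡ _)
  cast-* (suc m) n = begin
    cast (n ℕ.+ m ℕ.* n)         ≈⟨ cast-+ n (m ℕ.* n) ⟩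
    cast n + cast (m ℕ.* n)      ≈⟨ +-cong (sym (*-identityˡ _)) (cast-* m n) ⟩
    1# * cast n + cast m * cast n ≈⟨ sym (distribʳ _ _ _) ⟩
    (1# + cast m) * cast n ∎

  -- The coefficient map of the ring solver: coefficients are compared in ℤ, where equality is
  -- decidable. `castℤ (+ n)` reduces to `cast n`, so numerals in solver terms agree with those in
  -- the forms.
  castℤ : ℤ → Carrier
  castℤ (+ n)    = cast n
  castℤ -[1+ n ] = - cast (suc n)

  private
    sgn : Sign → Carrier → Carrier
    sgn Sign.+ x = x
    sgn Sign.- x = - x

    sgn-cong : ∀ s {x y} → x ≈ y → sgn s x ≈ sgn s y
    sgn-cong Sign.+ e = e
    sgn-cong Sign.- e = -‿cong e

    sgn-* : ∀ s t x y → sgn (s Sign.* t) (x * y) ≈ sgn s x * sgn t y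
    sgn-* Sign.+ Sign.+ x y = refl
    sgn-* Sign.+ Sign.- x y = -‿distribʳ-* x y
    sgn-* Sign.- Sign.+ x y = -‿distribˡ-* x y
    sgn-* Sign.- Sign.- x y = sym (-x*-y≈x*y x y)
      where
      -x*-y≈x*y : ∀ x y → - x * - y ≈ x * y
      -x*-y≈x*y x y = begin
        - x * - y     ≈⟨ sym (-‿distribˡ-* x (- y)) ⟩
        - (x * - y)   ≈⟨ -‿cong (sym (-‿distribʳ-* x y)) ⟩
        - (- (x * y)) ≈⟨ -‿involutive _ ⟩
        x * y ∎

    castℤ-◃ : ∀ s n → castℤ (s ◃ n) ≈ sgn s (cast n)
    castℤ-◃ Sign.+ zero    = refl
    castℤ-◃ Sign.+ (suc n) = refl
    castℤ-◃ Sign.- zero    = sym -0#≈0#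
    castℤ-◃ Sign.- (suc n) = refl

    castℤ-sgn : ∀ i → castℤ i ≈ sgn (ℤ.sign i) (cast ℤ.∣ i ∣)
    castℤ-sgn (+ n)    = refl
    castℤ-sgn -[1+ n ] = refl

    castℤ-⊖ : ∀ m n → castℤ (m ⊖ n) ≈ cast m - cast n
    castℤ-⊖ m       zero    = sym (trans (+-congˡ -0#≈0#) (+-identityʳ _))
    castℤ-⊖ zero    (suc n) = sym (+-identityˡ _)
    castℤ-⊖ (suc m) (suc n) = begin
      castℤ (suc m ⊖ suc n)               ≡⟨ ≡.cong castℤ (ℤₚ.[1+m]⊖[1+n]≡m⊖n m n) ⟩
      castℤ (m ⊖ n)                       ≈⟨ castℤ-⊖ m n ⟩
      cast m - cast n                     ≈⟨ +-congʳ (sym (trans (+-congˡ (-‿inverseʳ 1#)) (+-identityʳ _))) ⟩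
      (cast m + (1# - 1#)) - cast n       ≈⟨ +-congʳ (trans (sym (+-assoc _ _ _)) (+-congʳ (+-comm _ _))) ⟩
      ((1# + cast m) + - 1#) - cast n     ≈⟨ +-assoc _ _ _ ⟩
      (1# + cast m) + (- 1# + - cast n)   ≈⟨ +-congˡ (⁻¹-∙-comm 1# (cast n)) ⟩
      (1# + cast m) - (1# + cast n) ∎

    castℤ-+ : ∀ i j → castℤ (i ℤ.+ j) ≈ castℤ i + castℤ j
    castℤ-+ (+ m)    (+ n)    = cast-+ m n
    castℤ-+ (+ m)    -[1+ n ] = castℤ-⊖ m (suc n)
    castℤ-+ -[1+ m ] (+ n)    = trans (castℤ-⊖ n (suc m)) (+-comm _ _)
    castℤ-+ -[1+ m ] -[1+ n ] = begin
      - cast (suc (suc (m ℕ.+ n)))        ≡⟨ ≡.cong (λ k → - cast (suc k)) (≡.sym (ℕₚ.+-suc m n)) ⟩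
      - cast (suc m ℕ.+ suc n)            ≈⟨ -‿cong (cast-+ (suc m) (suc n)) ⟩
      - (cast (suc m) + cast (suc n))     ≈⟨ sym (⁻¹-∙-comm _ _) ⟩
      - cast (suc m) + - cast (suc n) ∎

    castℤ-* : ∀ i j → castℤ (i ℤ.* j) ≈ castℤ i * castℤ j
    castℤ-* i j = begin
      castℤ (i ℤ.* j)                                  ≈⟨ castℤ-◃ (ℤ.sign i Sign.* ℤ.sign j) (ℤ.∣ i ∣ ℕ.* ℤ.∣ j ∣) ⟩
      sgn s (cast (ℤ.∣ i ∣ ℕ.* ℤ.∣ j ∣))               ≈⟨ sgn-cong s (cast-* ℤ.∣ i ∣ ℤ.∣ j ∣) ⟩
      sgn s (cast ℤ.∣ i ∣ * cast ℤ.∣ j ∣)              ≈⟨ sgn-* (ℤ.sign i) (ℤ.sign j) _ _ ⟩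
      sgn (ℤ.sign i) (cast ℤ.∣ i ∣) * sgn (ℤ.sign j) (cast ℤ.∣ j ∣)
                                                       ≈⟨ *-cong (sym (castℤ-sgn i)) (sym (castℤ-sgn j)) ⟩
      castℤ i * castℤ j ∎
      where s = ℤ.sign i Sign.* ℤ.sign j

    castℤ-neg : ∀ i → castℤ (ℤ.- i) ≈ - castℤ i
    castℤ-neg (+ zero)  = sym -0#≈0#
    castℤ-neg (+ suc n) = refl
    castℤ-neg -[1+ n ]  = sym (-‿involutive _)

    castℤ-hom : ℤ.+-*-rawRing -Raw-AlmostCommutative⟶ fromCommutativeRing R
    castℤ-hom = record
      { ⟦_⟧    = castℤ
      ; +-homo = castℤ-+
      ; *-homo = castℤ-*
      ; -‿homo = castℤ-neg
      ; 0-homo = refl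
      ; 1-homo = +-identityʳ 1#
      }

    _≟ᶜ_ : WeaklyDecidable (Induced-equivalence castℤ-hom)
    i ≟ᶜ j with i ℤ.≟ j
    ... | yes e = just (reflexive (≡.cong castℤ e))
    ... | no  _ = nothing

  open Algebra.Solver.Ring ℤ.+-*-rawRing (fromCommutativeRing R) castℤ-hom _≟ᶜ_ public
    using (Polynomial; solve; _:=_; _:+_; _:*_; _:-_; :-_; _:^_; con)

  -- x :^ 0 rather than con (+ 1) at the bottom, so that the semantics is pow on the nose.
  _:↑_ : ∀ {m} → Polynomial m → ℕ → Polynomial m
  p :↑ zero  = p :^ 0
  p :↑ suc n = p :* (p :↑ n)

  :cast : ∀ {m} → ℕ → Polynomial m
  :cast n = con (+ n)

  pow-cong : ∀ n {x y} → x ≈ y → pow x n ≈ pow y n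
  pow-cong zero    e = refl
  pow-cong (suc n) e = *-cong e (pow-cong n e)

  pow-+ : ∀ x m n → pow x (m ℕ.+ n) ≈ pow x m * pow x n
  pow-+ x zero    n = sym (*-identityˡ _)
  pow-+ x (suc m) n = trans (*-congˡ (pow-+ x m n)) (sym (*-assoc _ _ _))

  pow-1# : ∀ n → pow 1# n ≈ 1#
  pow-1# zero    = refl
  pow-1# (suc n) = trans (*-identityˡ _) (pow-1# n)

  pow-distrib-* : ∀ x y n → pow (x * y) n ≈ pow x n * pow y n
  pow-distrib-* x y zero    = sym (*-identityˡ _)
  pow-distrib-* x y (suc n) = trans (*-congˡ (pow-distrib-* x y n))
    (solve 4 (λ a b c d → (a :* b) :* (c :* d) := (a :* c) :* (b :* d)) refl x y (pow x n) (pow y n))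

  pow-* : ∀ x m n → pow x (m ℕ.* n) ≈ pow (pow x n) m
  pow-* x zero    n = refl
  pow-* x (suc m) n = trans (pow-+ x n (m ℕ.* n)) (*-congˡ (pow-* x m n))

  sumTo-cong : ∀ N {f g : ℕ → Carrier} → (∀ i → f i ≈ g i) → sumTo N f ≈ sumTo N g
  sumTo-cong zero    e = refl
  sumTo-cong (suc N) e = +-cong (sumTo-cong N e) (e N)

  sumTo-0 : ∀ N {f : ℕ → Carrier} → (∀ i → f i ≈ 0#) → sumTo N f ≈ 0#
  sumTo-0 zero    e = refl
  sumTo-0 (suc N) e = trans (+-cong (sumTo-0 N e) (e N)) (+-identityˡ _)

  sumTo-*ˡ : ∀ N a (f : ℕ → Carrier) → a * sumTo N f ≈ sumTo N (λ i → a * f i)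
  sumTo-*ˡ zero    a f = zeroʳ a
  sumTo-*ˡ (suc N) a f = trans (distribˡ _ _ _) (+-congʳ (sumTo-*ˡ N a f))

  sumTo-+ : ∀ N (f g : ℕ → Carrier) → sumTo N f + sumTo N g ≈ sumTo N (λ i → f i + g i)
  sumTo-+ zero    f g = +-identityˡ _
  sumTo-+ (suc N) f g = trans
    (solve 4 (λ a b c d → (a :+ b) :+ (c :+ d) := (a :+ c) :+ (b :+ d)) refl (sumTo N f) (f N) (sumTo N g) (g N))
    (+-congʳ (sumTo-+ N f g))

-- Formal power series and the Euler derivation

module PowerSeries {c ℓ} (R : CommutativeRing c ℓ) where
  open CommutativeRing R
  open RingHelpers R
  open RingTools R
  open Relation.Binary.Reasoning.Setoid setoid

  Series : Set c
  Series = ℕ → Carrier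

  tail : Series → Series
  tail a n = a (suc n)

  infixl 7 _⊛_
  -- The Cauchy product by recursion on the left factor, which avoids sums over i + j = n. `⊛-suc`
  -- is the mirror-image recursion; commutativity rests on it.
  _⊛_ : Series → Series → Series
  (a ⊛ b) zero    = a 0 * b 0
  (a ⊛ b) (suc n) = a 0 * b (suc n) + (tail a ⊛ b) n

  infix 4 _≐_
  _≐_ : Series → Series → Set ℓ
  a ≐ b = ∀ n → a n ≈ b n

  const : Carrier → Series
  const x zero    = x
  const x (suc n) = 0#

  private
    0ˢ 1ˢ : Series
    0ˢ = const 0#
    1ˢ = const 1#

    _⊕_ : Series → Series → Series
    (a ⊕ b) n = a n + b n

    neg : Series → Series
    neg a n = - a n

    0ˢ≐0 : ∀ n → 0ˢ n ≈ 0#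
    0ˢ≐0 zero    = refl
    0ˢ≐0 (suc n) = refl

  ⊛-cong : ∀ {a a′ b b′} → a ≐ a′ → b ≐ b′ → a ⊛ b ≐ a′ ⊛ b′
  ⊛-cong p q zero    = *-cong (p 0) (q 0)
  ⊛-cong p q (suc n) = +-cong (*-cong (p 0) (q (suc n))) (⊛-cong (λ i → p (suc i)) q n)

  ⊛-suc : ∀ a b n → (a ⊛ b) (suc n) ≈ a (suc n) * b 0 + (a ⊛ tail b) n
  ⊛-suc a b zero    = +-comm _ _
  ⊛-suc a b (suc n) = trans (+-congˡ (⊛-suc (tail a) b n))
    (solve 3 (λ x y z → x :+ (y :+ z) := y :+ (x :+ z)) refl _ _ _)

  ⊛-comm : ∀ a b → a ⊛ b ≐ b ⊛ a
  ⊛-comm a b zero    = *-comm _ _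
  ⊛-comm a b (suc n) = trans (+-cong (*-comm _ _) (⊛-comm (tail a) b n)) (sym (⊛-suc b a n))

  ⊛-distribʳ : ∀ a b d → (b ⊕ d) ⊛ a ≐ (b ⊛ a) ⊕ (d ⊛ a)
  ⊛-distribʳ a b d zero    = distribʳ _ _ _
  ⊛-distribʳ a b d (suc n) = trans (+-cong (distribʳ _ _ _) (⊛-distribʳ a (tail b) (tail d) n))
    (solve 4 (λ x y z w → (x :+ y) :+ (z :+ w) := (x :+ z) :+ (y :+ w)) refl _ _ _ _)

  ⊛-scale : ∀ x a b n → ((λ i → x * a i) ⊛ b) n ≈ x * (a ⊛ b) n
  ⊛-scale x a b zero    = *-assoc _ _ _
  ⊛-scale x a b (suc n) = trans (+-cong (*-assoc _ _ _) (⊛-scale x (tail a) b n)) (sym (distribˡ _ _ _))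

  ⊛-assoc : ∀ a b d → (a ⊛ b) ⊛ d ≐ a ⊛ (b ⊛ d)
  ⊛-assoc a b d zero    = *-assoc _ _ _
  ⊛-assoc a b d (suc n) = begin
    a 0 * b 0 * d (suc n) + (tail (a ⊛ b) ⊛ d) n
      ≈⟨ +-congˡ (⊛-distribʳ d (λ i → a 0 * b (suc i)) (tail a ⊛ b) n) ⟩
    a 0 * b 0 * d (suc n) + (((λ i → a 0 * b (suc i)) ⊛ d) n + ((tail a ⊛ b) ⊛ d) n)
      ≈⟨ +-congˡ (+-cong (⊛-scale (a 0) (tail b) d n) (⊛-assoc (tail a) b d n)) ⟩
    a 0 * b 0 * d (suc n) + (a 0 * (tail b ⊛ d) n + (tail a ⊛ (b ⊛ d)) n)
      ≈⟨ solve 5 (λ x y z w t → x :* y :* z :+ (x :* w :+ t) := x :* (y :* z :+ w) :+ t) refl _ _ _ _ _ ⟩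
    a 0 * (b 0 * d (suc n) + (tail b ⊛ d) n) + (tail a ⊛ (b ⊛ d)) n ∎

  ⊛-zero : ∀ a b n → (∀ i → i ℕ.≤ n → a i ≈ 0#) → (a ⊛ b) n ≈ 0#
  ⊛-zero a b zero    e = trans (*-congʳ (e 0 z≤n)) (zeroˡ _)
  ⊛-zero a b (suc n) e = trans (+-cong (trans (*-congʳ (e 0 z≤n)) (zeroˡ _))
                                       (⊛-zero (tail a) b n (λ i i≤n → e (suc i) (s≤s i≤n))))
                               (+-identityˡ _)

  const-⊛ : ∀ x a n → (const x ⊛ a) n ≈ x * a n
  const-⊛ x a zero    = refl
  const-⊛ x a (suc n) = trans (+-congˡ (⊛-zero (tail (const x)) a n (λ _ _ → refl))) (+-identityʳ _)

  infix 4 _≋_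
  -- A record around `_≐_`, which would unfold to a function type: wrapped, the equality lets both
  -- series be inferred from a proof, as ring lemmas and the solver require.
  record _≋_ (a b : Series) : Set ℓ where
    constructor ⟪_⟫
    field coeff : a ≐ b
  open _≋_ public

  private
    ⊛-identityˡ : ∀ a → 1ˢ ⊛ a ≐ a
    ⊛-identityˡ a n = trans (const-⊛ 1# a n) (*-identityˡ _)

    seriesIsRing : IsCommutativeRing _≋_ _⊕_ _⊛_ neg 0ˢ 1ˢ
    seriesIsRing = record
      { isRing = record
        { +-isAbelianGroup = record
          { isGroup = record
            { isMonoid = record
              { isSemigroup = record
                { isMagma = record
                  { isEquivalence = record
                    { refl  = ⟪ (λ n → refl) ⟫
                    ; sym   = λ e → ⟪ (λ n → sym (coeff e n)) ⟫
                    ; trans = λ e f → ⟪ (λ n → trans (coeff e n) (coeff f n)) ⟫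
                    }
                  ; ∙-cong = λ e f → ⟪ (λ n → +-cong (coeff e n) (coeff f n)) ⟫
                  }
                ; assoc = λ a b d → ⟪ (λ n → +-assoc _ _ _) ⟫
                }
              ; identity = (λ a → ⟪ (λ n → trans (+-congʳ (0ˢ≐0 n)) (+-identityˡ _)) ⟫)
                         , (λ a → ⟪ (λ n → trans (+-congˡ (0ˢ≐0 n)) (+-identityʳ _)) ⟫)
              }
            ; inverse = (λ a → ⟪ (λ n → trans (-‿inverseˡ _) (sym (0ˢ≐0 n))) ⟫)
                      , (λ a → ⟪ (λ n → trans (-‿inverseʳ _) (sym (0ˢ≐0 n))) ⟫)
            ; ⁻¹-cong = λ e → ⟪ (λ n → -‿cong (coeff e n)) ⟫
            }
          ; comm = λ a b → ⟪ (λ n → +-comm _ _) ⟫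
          }
        ; *-cong = λ e f → ⟪ ⊛-cong (coeff e) (coeff f) ⟫
        ; *-assoc = λ a b d → ⟪ ⊛-assoc a b d ⟫
        ; *-identity = (λ a → ⟪ ⊛-identityˡ a ⟫)
                     , (λ a → ⟪ (λ n → trans (⊛-comm a 1ˢ n) (⊛-identityˡ a n)) ⟫)
        ; distrib = (λ a b d → ⟪ (λ n → trans (⊛-comm a (b ⊕ d) n)
                      (trans (⊛-distribʳ a b d n) (+-cong (⊛-comm b a n) (⊛-comm d a n)))) ⟫)
                  , (λ a b d → ⟪ ⊛-distribʳ a b d ⟫)
        }
      ; *-comm = λ a b → ⟪ ⊛-comm a b ⟫
      }

  seriesRing : CommutativeRing c ℓ
  seriesRing = record { isCommutativeRing = seriesIsRing }

  module S where
    open CommutativeRing seriesRing public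
    open RingHelpers seriesRing public
    open RingTools seriesRing public

  cast-const : ∀ n → S.cast n ≐ const (cast n)
  cast-const zero    i       = refl
  cast-const (suc n) zero    = +-congˡ (cast-const n 0)
  cast-const (suc n) (suc i) = trans (+-congˡ (cast-const n (suc i))) (+-identityˡ _)

  cast-⊛ : ∀ k a n → (S.cast k ⊛ a) n ≈ cast k * a n
  cast-⊛ k a n = trans (⊛-cong (cast-const k) (λ _ → refl) n) (const-⊛ (cast k) a n)

  sumTo-coeff : ∀ N (f : ℕ → Series) n → S.sumTo N f n ≈ sumTo N (λ i → f i n)
  sumTo-coeff zero    f n = 0ˢ≐0 n
  sumTo-coeff (suc N) f n = +-congʳ (sumTo-coeff N f n)

  X : Series
  X 0             = 0#
  X 1             = 1#
  X (suc (suc n)) = 0#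

  X-⊛-suc : ∀ a n → (X ⊛ a) (suc n) ≈ a n
  X-⊛-suc a n = trans (+-cong (zeroˡ _) (trans (⊛-cong tail-X (λ _ → refl) n) (⊛-identityˡ a n))) (+-identityˡ _)
    where
    tail-X : tail X ≐ 1ˢ
    tail-X zero    = refl
    tail-X (suc n) = refl

  X-⊛-zero : ∀ a → (X ⊛ a) 0 ≈ 0#
  X-⊛-zero a = zeroˡ _

  X^-⊛-≥ : ∀ k a n → (S.pow X k ⊛ a) (k ℕ.+ n) ≈ a n
  X^-⊛-≥ zero    a n = ⊛-identityˡ a n
  X^-⊛-≥ (suc k) a n = trans (⊛-assoc X (S.pow X k) a (suc k ℕ.+ n))
                       (trans (X-⊛-suc (S.pow X k ⊛ a) (k ℕ.+ n)) (X^-⊛-≥ k a n))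

  X^-⊛-< : ∀ k a n → n ℕ.< k → (S.pow X k ⊛ a) n ≈ 0#
  X^-⊛-< (suc k) a zero    _         = trans (⊛-assoc X (S.pow X k) a 0) (X-⊛-zero (S.pow X k ⊛ a))
  X^-⊛-< (suc k) a (suc n) (s≤s n<k) = trans (⊛-assoc X (S.pow X k) a (suc n))
                       (trans (X-⊛-suc (S.pow X k ⊛ a) n) (X^-⊛-< k a n n<k))

  X^-diag : ∀ k → S.pow X k k ≈ 1#
  X^-diag zero    = refl
  X^-diag (suc k) = trans (X-⊛-suc (S.pow X k) k) (X^-diag k)

  X^-offdiag : ∀ k n → ¬ (k ≡ n) → S.pow X k n ≈ 0#
  X^-offdiag zero    zero    k≢n = contradiction ≡.refl k≢n
  X^-offdiag zero    (suc n) k≢n = refl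
  X^-offdiag (suc k) zero    k≢n = X-⊛-zero (S.pow X k)
  X^-offdiag (suc k) (suc n) k≢n = trans (X-⊛-suc (S.pow X k) n) (X^-offdiag k n (λ e → k≢n (≡.cong suc e)))

  -- The Euler derivation y d/dy.
  D : Series → Series
  D a n = cast n * a n

  D-cong : ∀ {a b} → a ≋ b → D a ≋ D b
  D-cong e = ⟪ (λ n → *-congˡ (coeff e n)) ⟫

  D-+ : ∀ a b → D (a S.+ b) ≋ D a S.+ D b
  D-+ a b = ⟪ (λ n → distribˡ _ _ _) ⟫

  D-const : ∀ x → D (const x) ≋ S.0#
  D-const x = ⟪ (λ { zero → zeroˡ _ ; (suc n) → zeroʳ _ }) ⟫

  D-cast : ∀ k → D (S.cast k) ≋ S.0#
  D-cast k = S.trans (D-cong ⟪ cast-const k ⟫) (D-const _)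

  D-⊛ : ∀ a b → D (a ⊛ b) ≐ D a ⊛ b S.+ a ⊛ D b
  D-⊛ a b zero    = solve 2 (λ x y → :cast 0 :* (x :* y) := :cast 0 :* x :* y :+ x :* (:cast 0 :* y)) refl (a 0) (b 0)
  D-⊛ a b (suc n) = begin
    cast (suc n) * (a 0 * b (suc n) + t)
      ≈⟨ solve 4 (λ k x y t → (x :^ 0 :+ k) :* (y :+ t) := (x :^ 0 :+ k) :* y :+ (k :* t :+ t)) refl (cast n) (a 0) (a 0 * b (suc n)) t ⟩
    cast (suc n) * (a 0 * b (suc n)) + (cast n * t + t)
      ≈⟨ +-congˡ (+-congʳ (D-⊛ (tail a) b n)) ⟩
    cast (suc n) * (a 0 * b (suc n)) + ((D (tail a) ⊛ b) n + (tail a ⊛ D b) n + t)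
      ≈⟨ solve 6 (λ k x y u v t → k :* (x :* y) :+ (u :+ v :+ t) :=
                                  (:cast 0 :* x :* y :+ (u :+ t)) :+ (x :* (k :* y) :+ v))
           refl (cast (suc n)) (a 0) (b (suc n)) ((D (tail a) ⊛ b) n) ((tail a ⊛ D b) n) t ⟩
    (0# * a 0 * b (suc n) + ((D (tail a) ⊛ b) n + t)) + (a 0 * (cast (suc n) * b (suc n)) + (tail a ⊛ D b) n)
      ≈⟨ +-congʳ (+-congˡ (trans (sym (⊛-distribʳ b (D (tail a)) (tail a) n)) (⊛-cong tail-D (λ _ → refl) n))) ⟩
    (D a ⊛ b) (suc n) + (a ⊛ D b) (suc n) ∎
    where
    t = (tail a ⊛ b) n
    -- Passing to the tail lowers each index by one, so `D` loses one copy of the series; the extra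
    -- summand `t` supplies it.
    tail-D : (D (tail a) S.+ tail a) ≐ tail (D a)
    tail-D i = solve 2 (λ k x → k :* x :+ x := (x :^ 0 :+ k) :* x) refl (cast i) (a (suc i))

  D-* : ∀ a b → D (a S.* b) ≋ D a S.* b S.+ a S.* D b
  D-* a b = ⟪ D-⊛ a b ⟫

  D-pow : ∀ a n → D (S.pow a (suc n)) ≋ S.cast (suc n) S.* (S.pow a n S.* D a)
  D-pow a zero    = S.trans (D-* a S.1#) (S.trans (S.+-congˡ (S.*-congˡ (D-const 1#)))
    (S.solve 2 (λ x y → y S.:* x S.:^ 0 S.:+ x S.:* S.:cast 0 S.:= S.:cast 1 S.:* (x S.:^ 0 S.:* y)) S.refl a (D a)))
  D-pow a (suc n) = S.trans (D-* a (S.pow a (suc n))) (S.trans (S.+-congˡ (S.*-congˡ (D-pow a n)))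
    (S.solve 4 (λ x y p k → y S.:* (x S.:* p) S.:+ x S.:* ((x S.:^ 0 S.:+ k) S.:* (p S.:* y))
                       S.:= (x S.:^ 0 S.:+ (x S.:^ 0 S.:+ k)) S.:* ((x S.:* p) S.:* y))
       S.refl a (D a) (S.pow a n) (S.cast n)))

  D-X^ : ∀ k → D (S.pow X k) ≋ S.cast k S.* S.pow X k
  D-X^ k = ⟪ D-X^ᶜ ⟫
    where
    D-X^ᶜ : D (S.pow X k) ≐ S.cast k S.* S.pow X k
    D-X^ᶜ n with k ℕ.≟ n
    ... | yes ≡.refl = sym (cast-⊛ k (S.pow X k) k)
    ... | no  k≢n    = trans (*-congˡ (X^-offdiag k n k≢n)) (trans (zeroʳ _)
                       (sym (trans (cast-⊛ k (S.pow X k) n) (trans (*-congˡ (X^-offdiag k n k≢n)) (zeroʳ _)))))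

-- Polynomial functions and their coefficient series

module Representation {c ℓ} (K : AlgClosedFieldChar0 c ℓ) where
  open AlgClosedFieldChar0 K
  open RingTools commRing
  open PowerSeries commRing
  open Relation.Binary.Reasoning.Setoid setoid

  ev : ℕ → Series → Carrier → Carrier
  ev zero    a y = 0#
  ev (suc N) a y = a 0 + y * ev N (tail a) y

  Bounded : ℕ → Series → Set ℓ
  Bounded N a = ∀ i → N ℕ.≤ i → a i ≈ 0#

  Bounded-tail : ∀ {N a} → Bounded (suc N) a → Bounded N (tail a)
  Bounded-tail z i N≤i = z (suc i) (s≤s N≤i)

  Bounded-≤ : ∀ {M N a} → M ℕ.≤ N → Bounded M a → Bounded N a
  Bounded-≤ M≤N z i N≤i = z i (ℕₚ.≤-trans M≤N N≤i)

  ev-cong : ∀ N {a b} y → a ≋ b → ev N a y ≈ ev N b y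
  ev-cong zero    y e = refl
  ev-cong (suc N) y e = +-cong (coeff e 0) (*-congˡ (ev-cong N y ⟪ (λ n → coeff e (suc n)) ⟫))

  ev-+ : ∀ N a b y → ev N (a S.+ b) y ≈ ev N a y + ev N b y
  ev-+ zero    a b y = sym (+-identityˡ _)
  ev-+ (suc N) a b y = trans (+-congˡ (*-congˡ (ev-+ N (tail a) (tail b) y)))
    (solve 5 (λ a b y u v → (a :+ b) :+ y :* (u :+ v) := (a :+ y :* u) :+ (b :+ y :* v)) refl _ _ _ _ _)

  ev-scale : ∀ N x a y → ev N (λ i → x * a i) y ≈ x * ev N a y
  ev-scale zero    x a y = sym (zeroʳ _)
  ev-scale (suc N) x a y = trans (+-congˡ (*-congˡ (ev-scale N x (tail a) y)))
    (solve 4 (λ x a y u → x :* a :+ y :* (x :* u) := x :* (a :+ y :* u)) refl _ _ _ _)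

  ev-0 : ∀ N {a} y → (∀ i → a i ≈ 0#) → ev N a y ≈ 0#
  ev-0 zero    y z = refl
  ev-0 (suc N) y z = trans (+-cong (z 0) (trans (*-congˡ (ev-0 N y (λ i → z (suc i)))) (zeroʳ _))) (+-identityˡ _)

  ev-stable : ∀ {N N′ a} y → N ℕ.≤ N′ → Bounded N a → ev N′ a y ≈ ev N a y
  ev-stable {N′ = N′} y z≤n z = ev-0 N′ y (λ i → z i z≤n)
  ev-stable y (s≤s N≤N′) z = +-congˡ (*-congˡ (ev-stable y N≤N′ (Bounded-tail z)))

  ev-* : ∀ N M a b y → Bounded N a → Bounded M b → ev (N ℕ.+ M) (a S.* b) y ≈ ev N a y * ev M b y
  ev-* zero    M a b y za zb = trans (ev-0 M y (λ i → ⊛-zero a b i (λ j _ → za j z≤n))) (sym (zeroˡ _))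
  ev-* (suc N) M a b y za zb = begin
    a 0 * b 0 + y * ev (N ℕ.+ M) (λ i → a 0 * b (suc i) + (tail a ⊛ b) i) y
      ≈⟨ +-congˡ (*-congˡ (ev-+ (N ℕ.+ M) (λ i → a 0 * b (suc i)) (tail a ⊛ b) y)) ⟩
    a 0 * b 0 + y * (ev (N ℕ.+ M) (λ i → a 0 * b (suc i)) y + ev (N ℕ.+ M) (tail a ⊛ b) y)
      ≈⟨ +-congˡ (*-congˡ (+-cong (ev-scale (N ℕ.+ M) (a 0) (tail b) y) (ev-* N M (tail a) b y (Bounded-tail za) zb))) ⟩
    a 0 * b 0 + y * (a 0 * ev (N ℕ.+ M) (tail b) y + ev N (tail a) y * ev M b y)
      ≈⟨ solve 6 (λ a b y t u v → a :* b :+ y :* (a :* t :+ u :* v) := a :* (b :+ y :* t) :+ y :* u :* v) refl _ _ _ _ _ _ ⟩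
    a 0 * ev (suc N ℕ.+ M) b y + y * ev N (tail a) y * ev M b y
      ≈⟨ +-congʳ (*-congˡ (ev-stable y (ℕₚ.m≤n+m M (suc N)) zb)) ⟩
    a 0 * ev M b y + y * ev N (tail a) y * ev M b y
      ≈⟨ sym (distribʳ _ _ _) ⟩
    ev (suc N) a y * ev M b y ∎

  ⊛-Bounded : ∀ N M a b → Bounded N a → Bounded M b → Bounded (N ℕ.+ M) (a ⊛ b)
  ⊛-Bounded zero    M a b za zb i _ = ⊛-zero a b i (λ j _ → za j z≤n)
  ⊛-Bounded (suc N) M a b za zb (suc i) (s≤s N+M≤i) = trans
    (+-cong (trans (*-congˡ (zb (suc i) (ℕₚ.m≤n⇒m≤1+n (ℕₚ.≤-trans (ℕₚ.m≤n+m M N) N+M≤i)))) (zeroʳ _))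
            (⊛-Bounded N M (tail a) b (Bounded-tail za) zb i N+M≤i))
    (+-identityˡ _)

  -- Forms are functions, while the argument is about coefficients. The bound is only an upper
  -- bound, since an exact degree would require deciding whether coefficients vanish.
  record Represents (a : Series) (h : Carrier → Carrier) : Set (c ⊔ ℓ) where
    constructor represents
    field
      bound   : ℕ
      bounded : Bounded bound a
      value   : ∀ y → h y ≈ ev bound a y

  rep-cong : ∀ {a b h k} → a ≋ b → (∀ y → k y ≈ h y) → Represents a h → Represents b k
  rep-cong e f (represents N z v) = represents N
    (λ i N≤i → trans (sym (coeff e i)) (z i N≤i)) (λ y → trans (f y) (trans (v y) (ev-cong N y e)))

  rep-const : ∀ x → Represents (const x) (λ _ → x)
  rep-const x = represents 1 (λ { (suc i) _ → refl }) (λ y → sym (trans (+-congˡ (zeroʳ _)) (+-identityʳ _)))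

  rep-X : Represents X (λ y → y)
  rep-X = represents 2 (λ { (suc zero) (s≤s ()) ; (suc (suc i)) _ → refl })
    (λ y → solve 1 (λ y → y := :cast 0 :+ y :* (y :^ 0 :+ y :* :cast 0)) refl y)

  rep-+ : ∀ {a b h k} → Represents a h → Represents b k → Represents (a S.+ b) (λ y → h y + k y)
  rep-+ {a} {b} (represents N za va) (represents M zb vb) = represents (N ℕ.+ M)
    (λ i N+M≤i → trans (+-cong (Bounded-≤ N≤ za i N+M≤i) (Bounded-≤ M≤ zb i N+M≤i)) (+-identityˡ _))
    (λ y → trans (+-cong (trans (va y) (sym (ev-stable y N≤ za))) (trans (vb y) (sym (ev-stable y M≤ zb))))
                 (sym (ev-+ (N ℕ.+ M) a b y)))
    where
    N≤ : N ℕ.≤ N ℕ.+ M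
    N≤ = ℕₚ.m≤m+n N M
    M≤ : M ℕ.≤ N ℕ.+ M
    M≤ = ℕₚ.m≤n+m M N

  rep-* : ∀ {a b h k} → Represents a h → Represents b k → Represents (a S.* b) (λ y → h y * k y)
  rep-* {a} {b} (represents N za va) (represents M zb vb) = represents (N ℕ.+ M)
    (⊛-Bounded N M a b za zb) (λ y → trans (*-cong (va y) (vb y)) (sym (ev-* N M a b y za zb)))

  rep-neg : ∀ {a h} → Represents a h → Represents (S.- a) (λ y → - h y)
  rep-neg {a} {h} r = rep-cong
    (S.solve 1 (λ x → S.:- x S.:^ 0 S.:* x S.:= S.:- x) S.refl a)
    (λ y → solve 1 (λ x → :- x := :- x :^ 0 :* x) refl (h y))
    (rep-* (rep-cong ⟪ (λ { zero → refl ; (suc i) → sym (trans (sym (+-identityˡ _)) (-‿inverseʳ 0#)) }) ⟫ (λ _ → refl)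
      (rep-const (- 1#))) r)

  rep-pow : ∀ {a h} n → Represents a h → Represents (S.pow a n) (λ y → pow (h y) n)
  rep-pow zero    r = rep-const 1#
  rep-pow (suc n) r = rep-* r (rep-pow n r)

  rep-cast : ∀ n → Represents (S.cast n) (λ _ → cast n)
  rep-cast n = rep-cong ⟪ (λ i → sym (cast-const n i)) ⟫ (λ _ → refl) (rep-const (cast n))

  rep-sumTo : ∀ N {a : ℕ → Series} {h : ℕ → Carrier → Carrier} → (∀ i → Represents (a i) (h i)) →
              Represents (S.sumTo N a) (λ y → sumTo N (λ i → h i y))
  rep-sumTo zero    r = rep-const 0#
  rep-sumTo (suc N) r = rep-+ (rep-sumTo N r) (r N)

  x-y≈0⇒x≈y : ∀ {x y} → x - y ≈ 0# → x ≈ y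
  x-y≈0⇒x≈y {x} {y} e = begin
    x           ≈⟨ solve 2 (λ x y → x := (x :- y) :+ y) refl x y ⟩
    (x - y) + y ≈⟨ +-congʳ e ⟩
    0# + y      ≈⟨ +-identityˡ _ ⟩
    y ∎

  *-cancelˡ-0# : ∀ {x y} → ¬ (x ≈ 0#) → x * y ≈ 0# → y ≈ 0#
  *-cancelˡ-0# {x} {y} x≉0 xy≈0 with inverse x x≉0
  ... | x⁻¹ , xx⁻¹≈1 = begin
    y               ≈⟨ sym (*-identityˡ _) ⟩
    1# * y          ≈⟨ *-congʳ (sym xx⁻¹≈1) ⟩
    x * x⁻¹ * y     ≈⟨ solve 3 (λ x i y → x :* i :* y := i :* (x :* y)) refl x x⁻¹ y ⟩
    x⁻¹ * (x * y)   ≈⟨ *-congˡ xy≈0 ⟩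
    x⁻¹ * 0#        ≈⟨ zeroʳ _ ⟩
    0# ∎

  cast-distinct : ∀ {m n} → m ℕ.< n → ¬ (cast m - cast n ≈ 0#)
  cast-distinct {m} {n} m<n e = char0 (n ∸ suc m) (begin
    cast (suc (n ∸ suc m))
      ≈⟨ solve 2 (λ m k → k := (m :+ k) :- m) refl (cast m) _ ⟩
    (cast m + cast (suc (n ∸ suc m))) - cast m
      ≈⟨ +-congʳ (sym (cast-+ m _)) ⟩
    cast (m ℕ.+ suc (n ∸ suc m)) - cast m
      ≡⟨ ≡.cong (λ k → cast k - cast m) (≡.trans (ℕₚ.+-suc m _) (ℕₚ.m+[n∸m]≡n m<n)) ⟩
    cast n - cast m ≈⟨ +-congʳ (sym (x-y≈0⇒x≈y e)) ⟩
    cast m - cast m ≈⟨ -‿inverseʳ _ ⟩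
    0# ∎)

  ev-snoc : ∀ N a y → ev (suc N) a y ≈ ev N a y + a N * pow y N
  ev-snoc zero    a y = solve 2 (λ a y → a :+ y :* :cast 0 := :cast 0 :+ a :* (y :^ 0)) refl (a 0) y
  ev-snoc (suc N) a y = trans (+-congˡ (*-congˡ (ev-snoc N (tail a) y)))
    (solve 5 (λ a y u b p → a :+ y :* (u :+ b :* p) := (a :+ y :* u) :+ b :* (y :* p)) refl _ _ _ _ _)

  ev-dilate : ∀ N z a y → ev N a (z * y) ≈ ev N (λ i → pow z i * a i) y
  ev-dilate zero    z a y = refl
  ev-dilate (suc N) z a y = +-cong (sym (*-identityˡ _)) (begin
    z * y * ev N (tail a) (z * y)                         ≈⟨ *-congˡ (ev-dilate N z (tail a) y) ⟩
    z * y * ev N (λ i → pow z i * a (suc i)) y            ≈⟨ solve 3 (λ z y e → z :* y :* e := y :* (z :* e)) refl _ _ _ ⟩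
    y * (z * ev N (λ i → pow z i * a (suc i)) y)          ≈⟨ *-congˡ (sym (ev-scale N z _ y)) ⟩
    y * ev N (λ i → z * (pow z i * a (suc i))) y          ≈⟨ *-congˡ (ev-cong N y ⟪ (λ i → sym (*-assoc _ _ _)) ⟫) ⟩
    y * ev N (λ i → pow z (suc i) * a (suc i)) y ∎)

  cast-^ : ∀ m n → cast (m ℕ.^ n) ≈ pow (cast m) n
  cast-^ m zero    = +-identityʳ 1#
  cast-^ m (suc n) = trans (cast-* m (m ℕ.^ n)) (*-congˡ (cast-^ m n))

  -- P(2y) − 2^N P(y) has degree below N when P has degree N, and its
  -- coefficients are nonzero multiples of those of P.
  ev≈0⇒coeff≈0 : ∀ N a → (∀ y → ev N a y ≈ 0#) → ∀ i → i ℕ.< N → a i ≈ 0#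
  ev≈0⇒coeff≈0 (suc N) a ev≈0 = all
    where
    two = cast 2
    b : Series
    b i = (pow two i - pow two N) * a i

    ev-b : ∀ y → ev N b y ≈ 0#
    ev-b y = begin
      ev N b y
        ≈⟨ sym (trans (+-congˡ (trans (*-congʳ (trans (*-congʳ (-‿inverseʳ _)) (zeroˡ _))) (zeroˡ _))) (+-identityʳ _)) ⟩
      ev N b y + b N * pow y N
        ≈⟨ sym (ev-snoc N b y) ⟩
      ev (suc N) b y
        ≈⟨ ev-cong (suc N) {b} {(λ i → pow two i * a i) S.+ (λ i → - pow two N * a i)} y ⟪ (λ i → distribʳ _ _ _) ⟫ ⟩
      ev (suc N) ((λ i → pow two i * a i) S.+ (λ i → - pow two N * a i)) y
        ≈⟨ ev-+ (suc N) (λ i → pow two i * a i) (λ i → - pow two N * a i) y ⟩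
      ev (suc N) (λ i → pow two i * a i) y + ev (suc N) (λ i → - pow two N * a i) y
        ≈⟨ +-cong (sym (ev-dilate (suc N) two a y)) (ev-scale (suc N) (- pow two N) a y) ⟩
      ev (suc N) a (two * y) + - pow two N * ev (suc N) a y
        ≈⟨ +-cong (ev≈0 (two * y)) (trans (*-congˡ (ev≈0 y)) (zeroʳ _)) ⟩
      0# + 0#
        ≈⟨ +-identityˡ _ ⟩
      0# ∎

    below : ∀ i → i ℕ.< N → a i ≈ 0#
    below i i<N = *-cancelˡ-0#
      (λ e → cast-distinct (ℕₚ.^-monoʳ-< 2 (s≤s (s≤s z≤n)) i<N)
               (trans (+-cong (cast-^ 2 i) (-‿cong (cast-^ 2 N))) e))
      (ev≈0⇒coeff≈0 N b ev-b i i<N)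

    ev-below : ∀ M b → (∀ i → i ℕ.< M → b i ≈ 0#) → ev M b 1# ≈ 0#
    ev-below zero    b z = refl
    ev-below (suc M) b z = trans
      (+-cong (z 0 (s≤s z≤n)) (trans (*-congˡ (ev-below M (tail b) (λ i i<M → z (suc i) (s≤s i<M)))) (zeroʳ _)))
                                 (+-identityˡ _)

    top : a N ≈ 0#
    top = begin
      a N                          ≈⟨ sym (trans (*-congˡ (pow-1# N)) (*-identityʳ _)) ⟩
      a N * pow 1# N               ≈⟨ sym (trans (+-congʳ (ev-below N a below)) (+-identityˡ _)) ⟩
      ev N a 1# + a N * pow 1# N   ≈⟨ sym (ev-snoc N a 1#) ⟩
      ev (suc N) a 1#              ≈⟨ ev≈0 1# ⟩
      0# ∎

    all : ∀ i → i ℕ.< suc N → a i ≈ 0#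
    all i (s≤s i≤N) with i ℕ.≟ N
    ... | yes ≡.refl = top
    ... | no  i≢N    = below i (ℕₚ.≤∧≢⇒< i≤N i≢N)

  rep-0 : ∀ {a h} → Represents a h → (∀ y → h y ≈ 0#) → ∀ i → a i ≈ 0#
  rep-0 {a} (represents N z v) h≈0 i with i ℕ.<? N
  ... | yes i<N = ev≈0⇒coeff≈0 N a (λ y → trans (sym (v y)) (h≈0 y)) i i<N
  ... | no  i≮N = z i (ℕₚ.≮⇒≥ i≮N)

  rep-unique : ∀ {a b h k} → Represents a h → Represents b k → (∀ y → h y ≈ k y) → a ≋ b
  rep-unique ra rb h≈k = ⟪ (λ i → x-y≈0⇒x≈y
    (rep-0 (rep-+ ra (rep-neg rb)) (λ y → trans (+-congʳ (h≈k y)) (-‿inverseʳ _)) i)) ⟫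

-- Residues: the coefficients forced to vanish

module Residue {c ℓ} (K : AlgClosedFieldChar0 c ℓ) (κ′ p′ v′ c₁ c₂ C : ℕ) where
  open AlgClosedFieldChar0 K
  open RingTools commRing
  open PowerSeries commRing
  open Representation K

  private
    κ p v : ℕ
    κ = suc κ′
    p = suc p′
    v = suc v′

  -- `F′` is U dF/dU. `I` is the geometric series 1/(1 - U), given by its coefficients rather than
  -- as an abstract inverse because their positivity is used later.
  U F F′ I : Series
  U  = S.pow X κ
  F  = S.1# S.+ S.cast c₁ S.* U S.+ S.cast c₂ S.* (U S.* U)
  F′ = S.cast c₁ S.* U S.+ S.cast (2 ℕ.* c₂) S.* (U S.* U)

  indicator : ℕ → Carrier
  indicator zero    = 1#
  indicator (suc _) = 0#

  I n = indicator (n % κ)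

  1-U*I : (S.1# S.- U) S.* I S.≈ S.1#
  1-U*I = S.trans (S.solve 2 (λ u i → (u S.:^ 0 S.:- u) S.:* i S.:= i S.:- u S.:* i) S.refl U I) ⟪ coeffs ⟫
    where
    coeffs : ∀ n → (I S.- U S.* I) n ≈ const 1# n
    coeffs n with n ℕ.<? κ
    ... | yes n<κ = trans (+-congˡ (-‿cong (X^-⊛-< κ I n n<κ)))
                   (trans (solve 1 (λ x → x :- :cast 0 := x) refl (I n)) (low n n<κ))
      where
      low : ∀ n → n ℕ.< κ → I n ≈ const 1# n
      low zero    _   = refl
      low (suc n) n<κ = reflexive (≡.cong indicator (ℕ-div.m<n⇒m%n≡m n<κ))
    ... | no n≮κ with ℕₚ.m≤n⇒∃[o]m+o≡n (ℕₚ.≮⇒≥ n≮κ)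
    ...   | m , ≡.refl = trans (+-cong (reflexive (≡.cong indicator κ+m%κ)) (-‿cong (X^-⊛-≥ κ I m))) (-‿inverseʳ (I m))
      where
      κ+m%κ : (κ ℕ.+ m) % κ ≡ m % κ
      κ+m%κ = ≡.trans (≡.cong (_% κ) (ℕₚ.+-comm κ m)) (ℕ-div.[m+n]%n≡m%n m κ)

  D-U : D U S.≈ S.cast κ S.* U
  D-U = D-X^ κ

  D-F : D F S.≈ S.cast κ S.* F′
  D-F = S.trans (D-+ _ _) (S.trans (S.+-cong
      (S.trans (D-+ _ _) (S.+-cong (D-const 1#) (S.trans (D-* _ _) (S.+-cong (S.*-congʳ (D-cast c₁)) (S.*-congˡ D-U)))))
      (S.trans (D-* _ _) (S.+-cong (S.*-congʳ (D-cast c₂)) (S.*-congˡ (S.trans (D-* _ _) (S.+-cong (S.*-congʳ D-U) (S.*-congˡ D-U)))))))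
    (S.trans (S.solve 4 (λ u k a b → (S.:cast 0 S.:+ (S.:cast 0 S.:* u S.:+ a S.:* (k S.:* u)))
                           S.:+ (S.:cast 0 S.:* (u S.:* u) S.:+ b S.:* (k S.:* u S.:* u S.:+ u S.:* (k S.:* u)))
                         S.:= k S.:* (a S.:* u S.:+ S.:cast 2 S.:* b S.:* (u S.:* u))) S.refl U (S.cast κ) (S.cast c₁) (S.cast c₂))
      (S.*-congˡ (S.+-congˡ (S.*-congʳ (S.sym (S.cast-* 2 c₂)))))))

  -- Differentiate (1 - U) I = 1, then multiply by I to isolate `D I`.
  D-I : D I S.≈ S.cast κ S.* U S.* I S.* I
  D-I = begin
    D I
      ≈⟨ S.sym (S.*-identityˡ _) ⟩
    S.1# S.* D I
      ≈⟨ S.*-congʳ (S.sym 1-U*I) ⟩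
    (S.1# S.- U) S.* I S.* D I
      ≈⟨ S.solve 4 (λ u i d k → (u S.:^ 0 S.:- u) S.:* i S.:* d
                      S.:= i S.:* ((S.:cast 0 S.:- k) S.:* i S.:+ (u S.:^ 0 S.:- u) S.:* d) S.:+ k S.:* i S.:* i)
           S.refl U I (D I) (S.cast κ S.* U) ⟩
    I S.* ((S.0# S.- S.cast κ S.* U) S.* I S.+ (S.1# S.- U) S.* D I) S.+ S.cast κ S.* U S.* I S.* I
      ≈⟨ S.+-congʳ (S.*-congˡ (S.sym (S.trans (D-* (S.1# S.- U) I) (S.+-congʳ (S.*-congʳ D-1-U))))) ⟩
    I S.* D ((S.1# S.- U) S.* I) S.+ S.cast κ S.* U S.* I S.* I
      ≈⟨ S.+-congʳ (S.*-congˡ (S.trans (D-cong 1-U*I) (D-const 1#))) ⟩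
    I S.* S.0# S.+ S.cast κ S.* U S.* I S.* I
      ≈⟨ S.trans (S.+-congʳ (S.zeroʳ I)) (S.+-identityˡ _) ⟩
    S.cast κ S.* U S.* I S.* I ∎
    where
    open Relation.Binary.Reasoning.Setoid S.setoid
    D-neg : ∀ a → D (S.- a) S.≈ S.- D a
    D-neg a = ⟪ (λ n → solve 2 (λ k x → k :* :- x := :- (k :* x)) refl (cast n) (a n)) ⟫
    D-1-U : D (S.1# S.- U) S.≈ S.0# S.- S.cast κ S.* U
    D-1-U = S.trans (D-+ S.1# (S.- U)) (S.+-cong (D-const 1#) (S.trans (D-neg U) (S.-‿cong D-U)))

  -- `derivative` is the formula for y t′/t with its denominator F (1 - U) cleared and the factor κ
  -- removed. Both hypotheses are thus polynomial identities in U.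
  module Vanishing (G : Series)
    (syzygy     : S.pow G 2 S.+ S.cast C S.* (U S.* S.pow (S.1# S.- U) v) S.≈ S.pow F p)
    (derivative : S.cast p S.* (F′ S.* (S.1# S.- U)) S.+ S.cast v S.* (U S.* F) S.+ G S.≈ F S.* (S.1# S.- U))
    where
    open Relation.Binary.Reasoning.Setoid S.setoid

    -- With t = U (1 − U)ᵛ / Fᵖ:  E = U / t,  V = E G² / Fᵖ  and  κ H = E (D t) / t.
    E V H : Series
    E = S.pow F p S.* S.pow I v
    V = S.pow G 2 S.* S.pow I v
    H = S.pow F p′ S.* S.pow I (suc v) S.* G

    -- The syzygy divided by (1 - U)ᵛ. This is how even powers of G are traded for powers of E.
    V≈E-CU : V S.≈ E S.- S.cast C S.* U
    V≈E-CU = begin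
      S.pow G 2 S.* Iᵛ
        ≈⟨ S.solve 5 (λ g i c u w → g S.:* i S.:= (g S.:+ c S.:* (u S.:* w)) S.:* i S.:- c S.:* u S.:* (w S.:* i))
             S.refl (S.pow G 2) Iᵛ (S.cast C) U wᵛ ⟩
      (S.pow G 2 S.+ S.cast C S.* (U S.* wᵛ)) S.* Iᵛ S.- S.cast C S.* U S.* (wᵛ S.* Iᵛ)
        ≈⟨ S.+-congʳ (S.*-congʳ syzygy) ⟩
      E S.- S.cast C S.* U S.* (wᵛ S.* Iᵛ)
        ≈⟨ S.+-congˡ (S.-‿cong (S.trans (S.*-congˡ cancel) (S.*-identityʳ _))) ⟩
      E S.- S.cast C S.* U ∎
      where
      Iᵛ = S.pow I v
      wᵛ = S.pow (S.1# S.- U) v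
      cancel : wᵛ S.* Iᵛ S.≈ S.1#
      cancel = S.trans (S.sym (S.pow-distrib-* (S.1# S.- U) I v)) (S.trans (S.pow-cong v 1-U*I) (S.pow-1# v))

    -- As E = U/t, its logarithmic derivative is κ - (D t)/t; multiply by E.
    D-E : D E S.+ S.cast κ S.* H S.≈ S.cast κ S.* E
    D-E = begin
      D E S.+ S.cast κ S.* H
        ≈⟨ S.+-congʳ (S.trans (D-* _ _) (S.+-cong
             (S.*-congʳ (S.trans (D-pow F p′) (S.*-congˡ (S.*-congˡ D-F))))
             (S.*-congˡ (S.trans (D-pow I v′) (S.*-congˡ (S.*-congˡ D-I)))))) ⟩
      P S.* (a S.* (k S.* F′)) S.* (I S.* b) S.+ F S.* a S.* (W S.* (b S.* (k S.* U S.* I S.* I)))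
        S.+ k S.* (a S.* (I S.* (I S.* b)) S.* G)
        ≈⟨ S.solve 10 (λ P a k F′ I b F W U G →
              P S.:* (a S.:* (k S.:* F′)) S.:* (I S.:* b) S.:+ F S.:* a S.:* (W S.:* (b S.:* (k S.:* U S.:* I S.:* I)))
              S.:+ k S.:* (a S.:* (I S.:* (I S.:* b)) S.:* G)
              S.:= k S.:* a S.:* b S.:* I S.:* (P S.:* F′ S.:* P S.:^ 0 S.:+ I S.:* (W S.:* (U S.:* F) S.:+ G)))
            S.refl P a k F′ I b F W U G ⟩
      k S.* a S.* b S.* I S.* (P S.* F′ S.* S.1# S.+ I S.* (W S.* (U S.* F) S.+ G))
        -- The term with F′ lacks one factor I; inserting (1 - U) I brings all three terms over one
        -- denominator, so that `derivative` applies.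
        ≈⟨ S.*-congˡ (S.+-congʳ (S.*-congˡ (S.sym 1-U*I))) ⟩
      k S.* a S.* b S.* I S.* (P S.* F′ S.* ((S.1# S.- U) S.* I) S.+ I S.* (W S.* (U S.* F) S.+ G))
        ≈⟨ S.solve 7 (λ q P F′ w I x G → q S.:* (P S.:* F′ S.:* (w S.:* I) S.:+ I S.:* (x S.:+ G))
              S.:= q S.:* I S.:* (P S.:* (F′ S.:* w) S.:+ x S.:+ G))
            S.refl (k S.* a S.* b S.* I) P F′ (S.1# S.- U) I (W S.* (U S.* F)) G ⟩
      k S.* a S.* b S.* I S.* I S.* (P S.* (F′ S.* (S.1# S.- U)) S.+ W S.* (U S.* F) S.+ G)
        ≈⟨ S.*-congˡ derivative ⟩
      k S.* a S.* b S.* I S.* I S.* (F S.* (S.1# S.- U))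
        ≈⟨ S.solve 6 (λ k a b I F w → k S.:* a S.:* b S.:* I S.:* I S.:* (F S.:* w)
              S.:= k S.:* (F S.:* a S.:* (I S.:* b)) S.:* (w S.:* I)) S.refl k a b I F (S.1# S.- U) ⟩
      k S.* E S.* ((S.1# S.- U) S.* I)
        ≈⟨ S.trans (S.*-congˡ 1-U*I) (S.*-identityʳ _) ⟩
      k S.* E ∎
      where
      P = S.cast p
      W = S.cast v
      k = S.cast κ
      a = S.pow F p′
      b = S.pow I v′

    -- The factor (i + 1)κ is decisive: at the index (i + 1)κ the derivation multiplies by the same
    -- integer, so the contribution of E^(i+1) cancels from both sides.
    D-E^ : ∀ i → D (S.pow E (suc i)) S.≈ S.cast (suc i ℕ.* κ) S.* (S.pow E (suc i) S.- S.pow E i S.* H)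
    D-E^ i = begin
      D (S.pow E (suc i))
        ≈⟨ D-pow E i ⟩
      S.cast (suc i) S.* (S.pow E i S.* D E)
        ≈⟨ S.solve 5 (λ n e d k h → n S.:* (e S.:* d) S.:= n S.:* (e S.:* ((d S.:+ k S.:* h) S.:- k S.:* h)))
             S.refl (S.cast (suc i)) (S.pow E i) (D E) (S.cast κ) H ⟩
      S.cast (suc i) S.* (S.pow E i S.* ((D E S.+ S.cast κ S.* H) S.- S.cast κ S.* H))
        ≈⟨ S.*-congˡ (S.*-congˡ (S.+-congʳ D-E)) ⟩
      S.cast (suc i) S.* (S.pow E i S.* (S.cast κ S.* E S.- S.cast κ S.* H))
        ≈⟨ S.solve 5 (λ n e E k h → n S.:* (e S.:* (k S.:* E S.:- k S.:* h)) S.:= n S.:* k S.:* (E S.:* e S.:- e S.:* h))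
             S.refl (S.cast (suc i)) (S.pow E i) E (S.cast κ) H ⟩
      S.cast (suc i) S.* S.cast κ S.* (S.pow E (suc i) S.- S.pow E i S.* H)
        ≈⟨ S.*-congʳ (S.sym (S.cast-* (suc i) κ)) ⟩
      S.cast (suc i ℕ.* κ) S.* (S.pow E (suc i) S.- S.pow E i S.* H) ∎

    -- The residue of an exact differential vanishes.
    E^*H-coeff : ∀ i → (S.pow E i S.* H) (suc i ℕ.* κ) ≈ 0#
    E^*H-coeff i = *-cancelˡ-0# (char0 (κ′ ℕ.+ i ℕ.* κ))
      (trans (solve 3 (λ k e h → k :* h := k :* e :- k :* (e :- h)) refl (cast n) (S.pow E (suc i) n) _)
      (trans (+-congʳ (trans (coeff (D-E^ i) n) (cast-⊛ n _ n))) (-‿inverseʳ _)))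
      where
      n = suc i ℕ.* κ

    -- Induction on b, replacing one V by E - C U. The E raises i by one, and the U lowers the index
    -- by κ; in both cases the index again matches the total exponent b + i.
    E^*V^*H-coeff : ∀ b i → (S.pow E i S.* S.pow V b S.* H) (suc (b ℕ.+ i) ℕ.* κ) ≈ 0#
    E^*V^*H-coeff zero    i = trans (coeff (S.*-congʳ {H} (S.*-identityʳ (S.pow E i))) (suc i ℕ.* κ)) (E^*H-coeff i)
    E^*V^*H-coeff (suc b) i = trans (coeff expand n) (trans (+-cong first (-‿cong second)) (-‿inverseʳ 0#))
      where
      n = suc (suc b ℕ.+ i) ℕ.* κ
      T = S.pow E i S.* S.pow V b S.* H
      expand : S.pow E i S.* S.pow V (suc b) S.* H
               S.≈ S.pow E (suc i) S.* S.pow V b S.* H S.- S.cast C S.* (U S.* T)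
      expand = S.trans (S.*-congʳ (S.*-congˡ (S.*-congʳ V≈E-CU)))
        (S.solve 6 (λ e E c u w h → e S.:* ((E S.:- c S.:* u) S.:* w) S.:* h
                    S.:= E S.:* e S.:* w S.:* h S.:- c S.:* (u S.:* (e S.:* w S.:* h)))
          S.refl (S.pow E i) E (S.cast C) U (S.pow V b) H)
      first : (S.pow E (suc i) S.* S.pow V b S.* H) n ≈ 0#
      first = ≡.subst (λ m → (S.pow E (suc i) S.* S.pow V b S.* H) (suc m ℕ.* κ) ≈ 0#) (ℕₚ.+-suc b i) (E^*V^*H-coeff b (suc i))
      second : (S.cast C S.* (U S.* T)) n ≈ 0#
      second = trans (cast-⊛ C (U S.* T) n)
        (trans (*-congˡ (trans (X^-⊛-≥ κ T (suc (b ℕ.+ i) ℕ.* κ)) (E^*V^*H-coeff b i))) (zeroʳ _))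

    multiplier : ℕ → ℕ → Series
    multiplier e μ = S.pow F (p′ ∸ e) S.* (S.pow I (suc v) S.* S.pow (S.pow I v) μ)

    -- Of the μ = b + i factors Iᵛ in the multiplier, i join F^(ip) to form Eⁱ and b join G^(2b) to
    -- form Vᵇ. What remains, Fᵉ F^(p-1-e) I^(v+1) G, is H whatever e is.
    term-coeff : ∀ e b i → e ℕ.≤ p′ →
      (S.pow F (e ℕ.+ i ℕ.* p) S.* S.pow G (suc (b ℕ.* 2)) S.* multiplier e (b ℕ.+ i)) (suc (b ℕ.+ i) ℕ.* κ) ≈ 0#
    term-coeff e b i e≤p′ = trans (coeff rearrange (suc (b ℕ.+ i) ℕ.* κ)) (E^*V^*H-coeff b i)
      where
      rearrange : S.pow F (e ℕ.+ i ℕ.* p) S.* S.pow G (suc (b ℕ.* 2)) S.* multiplier e (b ℕ.+ i)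
                  S.≈ S.pow E i S.* S.pow V b S.* H
      rearrange = begin
        S.pow F (e ℕ.+ i ℕ.* p) S.* S.pow G (suc (b ℕ.* 2)) S.* multiplier e (b ℕ.+ i)
          ≈⟨ S.*-cong (S.*-cong (S.trans (S.pow-+ F e (i ℕ.* p)) (S.*-congˡ (S.pow-* F i p))) (S.*-congˡ (S.pow-* G b 2)))
                      (S.*-congˡ (S.*-congˡ (S.pow-+ (S.pow I v) b i))) ⟩
        S.pow F e S.* fᵢ S.* (G S.* g_b) S.* (S.pow F (p′ ∸ e) S.* (J S.* (j_b S.* jᵢ)))
          ≈⟨ S.solve 8 (λ x f G g y J jb ji → x S.:* f S.:* (G S.:* g) S.:* (y S.:* (J S.:* (jb S.:* ji)))
               S.:= f S.:* ji S.:* (g S.:* jb) S.:* ((x S.:* y) S.:* J S.:* G))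
               S.refl (S.pow F e) fᵢ G g_b (S.pow F (p′ ∸ e)) J j_b jᵢ ⟩
        fᵢ S.* jᵢ S.* (g_b S.* j_b) S.* ((S.pow F e S.* S.pow F (p′ ∸ e)) S.* J S.* G)
          ≈⟨ S.*-cong (S.*-cong (S.sym (S.pow-distrib-* _ _ i)) (S.sym (S.pow-distrib-* _ _ b)))
               (S.*-congʳ (S.*-congʳ (S.trans (S.sym (S.pow-+ F e (p′ ∸ e)))
                 (S.reflexive (≡.cong (S.pow F) (ℕₚ.m+[n∸m]≡n e≤p′)))))) ⟩
        S.pow E i S.* S.pow V b S.* H ∎
        where
        fᵢ = S.pow (S.pow F p) i
        g_b = S.pow (S.pow G 2) b
        J = S.pow I (suc v)
        j_b = S.pow (S.pow I v) b
        jᵢ = S.pow (S.pow I v) i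

  -- Positivity of the multiplier

  -- K carries no order, so signs are expressed through images of natural numbers; characteristic 0
  -- makes the positive ones nonzero.
  IsNat IsPos : Carrier → Set ℓ
  IsNat x = ∃ λ n → x ≈ cast n
  IsPos x = ∃ λ n → x ≈ cast (suc n)

  IsNat-+ : ∀ {x y} → IsNat x → IsNat y → IsNat (x + y)
  IsNat-+ (m , e) (n , f) = m ℕ.+ n , trans (+-cong e f) (sym (cast-+ m n))

  IsNat-* : ∀ {x y} → IsNat x → IsNat y → IsNat (x * y)
  IsNat-* (m , e) (n , f) = m ℕ.* n , trans (*-cong e f) (sym (cast-* m n))

  IsPos-+ : ∀ {x y} → IsPos x → IsNat y → IsPos (x + y)
  IsPos-+ (m , e) (n , f) = m ℕ.+ n , trans (+-cong e f) (sym (cast-+ (suc m) n))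

  IsPos-* : ∀ {x y} → IsPos x → IsPos y → IsPos (x * y)
  IsPos-* (m , e) (n , f) = n ℕ.+ m ℕ.* suc n , trans (*-cong e f) (sym (cast-* (suc m) (suc n)))

  Natural : Series → Set ℓ
  Natural a = ∀ n → IsNat (a n)

  Natural-⊛ : ∀ a b → Natural a → Natural b → Natural (a ⊛ b)
  Natural-⊛ a b za zb zero    = IsNat-* (za 0) (zb 0)
  Natural-⊛ a b za zb (suc n) = IsNat-+ (IsNat-* (za 0) (zb (suc n))) (Natural-⊛ (tail a) b (λ i → za (suc i)) zb n)

  Natural-const : ∀ n → Natural (const (cast n))
  Natural-const n zero    = n , refl
  Natural-const n (suc i) = 0 , refl

  Natural-cast : ∀ n → Natural (S.cast n)
  Natural-cast n i with Natural-const n i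
  ... | m , e = m , trans (cast-const n i) e

  Natural-X : Natural X
  Natural-X zero          = 0 , refl
  Natural-X (suc zero)    = 1 , sym (+-identityʳ 1#)
  Natural-X (suc (suc i)) = 0 , refl

  Natural-1 : Natural S.1#
  Natural-1 zero    = 1 , sym (+-identityʳ 1#)
  Natural-1 (suc i) = 0 , refl

  Natural-pow : ∀ a n → Natural a → Natural (S.pow a n)
  Natural-pow a zero    z = Natural-1
  Natural-pow a (suc n) z = Natural-⊛ a _ z (Natural-pow a n z)

  -- A series in U has zero coefficients off the multiples of κ, so positivity is asked only there.
  -- One such factor is enough in a product: the others need only natural coefficients and a
  -- positive constant term, since no cancellation can occur.
  Positive₀ Positiveκ : Series → Set ℓ
  Positive₀ a = Natural a × IsPos (a 0)
  Positiveκ a = Natural a × (∀ m → IsPos (a (m ℕ.* κ)))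

  Positive₀-⊛-Positiveκ : ∀ a b → Positive₀ a → Positiveκ b → Positiveκ (a ⊛ b)
  Positive₀-⊛-Positiveκ a b (na , pa) (nb , pb) = Natural-⊛ a b na nb , pos
    where
    leading : ∀ n → IsPos (b n) → IsPos ((a ⊛ b) n)
    leading zero    pn = IsPos-* pa pn
    leading (suc n) pn = IsPos-+ (IsPos-* pa pn) (Natural-⊛ (tail a) b (λ i → na (suc i)) nb n)
    pos : ∀ m → IsPos ((a ⊛ b) (m ℕ.* κ))
    pos m = leading (m ℕ.* κ) (pb m)

  Positive₀-pow : ∀ a n → Positive₀ a → Positive₀ (S.pow a n)
  Positive₀-pow a zero    u = Natural-1 , 0 , sym (+-identityʳ 1#)
  Positive₀-pow a (suc n) u = Natural-pow a (suc n) (proj₁ u) , IsPos-* (proj₂ u) (proj₂ (Positive₀-pow a n u))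

  Positiveκ⇒Positive₀ : ∀ {a} → Positiveκ a → Positive₀ a
  Positiveκ⇒Positive₀ (n , z) = n , z 0

  Positiveκ-cong : ∀ {a b} → a S.≈ b → Positiveκ a → Positiveκ b
  Positiveκ-cong e (z , q) = (λ n → proj₁ (z n) , trans (sym (coeff e n)) (proj₂ (z n)))
                          , (λ m → proj₁ (q m) , trans (sym (coeff e (m ℕ.* κ))) (proj₂ (q m)))

  Positiveκ-I : Positiveκ I
  Positiveκ-I = (λ n → nat (n % κ)) , (λ m → 0 , trans (reflexive (≡.cong indicator (ℕ-div.m*n%n≡0 m κ))) (sym (+-identityʳ 1#)))
    where
    nat : ∀ r → IsNat (indicator r)
    nat zero    = 1 , sym (+-identityʳ 1#)
    nat (suc r) = 0 , refl

  Positiveκ-I^ : ∀ n → Positiveκ (S.pow I (suc n))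
  Positiveκ-I^ zero    = Positiveκ-cong (S.sym (S.*-identityʳ I)) Positiveκ-I
  Positiveκ-I^ (suc n) = Positive₀-⊛-Positiveκ I _ (Positiveκ⇒Positive₀ Positiveκ-I) (Positiveκ-I^ n)

  Positive₀-F : Positive₀ F
  Positive₀-F = nat , 0 , constant-term
    where
    nat-U : Natural U
    nat-U = Natural-pow X κ Natural-X
    nat : Natural F
    nat n = IsNat-+ (IsNat-+ (Natural-1 n) (Natural-⊛ _ _ (Natural-cast c₁) nat-U n))
                    (Natural-⊛ _ _ (Natural-cast c₂) (Natural-⊛ U U nat-U nat-U) n)
    U₀ : U 0 ≈ 0#
    U₀ = X-⊛-zero (S.pow X κ′)
    constant-term : F 0 ≈ cast 1
    constant-term = trans (+-cong (+-congˡ (*-congˡ U₀)) (*-congˡ (*-congʳ U₀)))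
      (solve 3 (λ a b U₀ → a :^ 0 :+ a :* :cast 0 :+ b :* (:cast 0 :* U₀) := :cast 1) refl (S.cast c₁ 0) (S.cast c₂ 0) (U 0))

  Positiveκ-multiplier : ∀ k μ → Positiveκ (S.pow F k S.* (S.pow I (suc v) S.* S.pow (S.pow I v) μ))
  Positiveκ-multiplier k μ = Positive₀-⊛-Positiveκ _ _ (Positive₀-pow F k Positive₀-F)
    -- I^(v+1) is the factor positive at every multiple of κ, hence moved to the right; (Iᵛ)^μ
    -- cannot play this role, being 1 for μ = 0.
    (Positiveκ-cong (S.*-comm _ _)
      (Positive₀-⊛-Positiveκ _ _ (Positive₀-pow (S.pow I v) μ (Positiveκ⇒Positive₀ (Positiveκ-I^ v′))) (Positiveκ-I^ v)))

-- Exponents of the monomials in a given degree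

parity : ∀ n → (∃ λ h → n ≡ h ℕ.* 2) ⊎ (∃ λ h → n ≡ suc (h ℕ.* 2))
parity zero    = inj₁ (0 , ≡.refl)
parity (suc n) with parity n
... | inj₁ (h , ≡.refl) = inj₂ (h , ≡.refl)
... | inj₂ (h , ≡.refl) = inj₁ (suc h , ≡.refl)

-- n is the degree of fᵃ g²ʰ⁺¹, and 2β = pα the common degree of fᵖ and g².
exponents : ∀ α β p n a h .{{_ : ℕ.NonZero α}} .{{_ : ℕ.NonZero (2 ℕ.* β)}} →
  p ℕ.* α ≡ 2 ℕ.* β → α ℕ.* a ℕ.+ β ℕ.* suc (h ℕ.* 2) ≡ n →
  ∃ λ i → h ℕ.+ i ≡ (n ∸ β) ℕ./ (2 ℕ.* β) × a ≡ ((n ∸ β) % (2 ℕ.* β)) ℕ./ α ℕ.+ i ℕ.* p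
exponents α β p n a h pα≡m deg = i , h+i≡μ , a≡
  where
  open ≡.≡-Reasoning
  m = 2 ℕ.* β
  μ = (n ∸ β) ℕ./ m
  ρ = (n ∸ β) % m
  i = μ ∸ h

  split : α ℕ.* a ℕ.+ h ℕ.* m ≡ n ∸ β
  split = begin
    α ℕ.* a ℕ.+ h ℕ.* m                       ≡⟨ ℕₚ.m+n∸n≡m _ β ⟨
    α ℕ.* a ℕ.+ h ℕ.* m ℕ.+ β ∸ β             ≡⟨ ≡.cong (_∸ β) (lemma α a h β) ⟩
    α ℕ.* a ℕ.+ β ℕ.* suc (h ℕ.* 2) ∸ β       ≡⟨ ≡.cong (_∸ β) deg ⟩
    n ∸ β ∎
    where
    lemma : ∀ α a h β → α ℕ.* a ℕ.+ h ℕ.* (2 ℕ.* β) ℕ.+ β ≡ α ℕ.* a ℕ.+ β ℕ.* suc (h ℕ.* 2)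
    lemma = solve-∀

  h≤μ : h ℕ.≤ μ
  h≤μ = ≡.subst (ℕ._≤ μ) (ℕ-div.m*n/n≡m h m)
          (ℕ-div./-monoˡ-≤ m (≡.subst (h ℕ.* m ℕ.≤_) split (ℕₚ.m≤n+m (h ℕ.* m) (α ℕ.* a))))

  h+i≡μ : h ℕ.+ i ≡ μ
  h+i≡μ = ℕₚ.m+[n∸m]≡n h≤μ

  -- This forces α to divide ρ as soon as a monomial of degree n exists, so the quotient ρ / α below
  -- is exact.
  αa≡ : a ℕ.* α ≡ ρ ℕ.+ (i ℕ.* p) ℕ.* α
  αa≡ = ℕₚ.+-cancelʳ-≡ (h ℕ.* m) _ _ (begin
    a ℕ.* α ℕ.+ h ℕ.* m                       ≡⟨ ≡.cong (ℕ._+ h ℕ.* m) (ℕₚ.*-comm a α) ⟩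
    α ℕ.* a ℕ.+ h ℕ.* m                       ≡⟨ split ⟩
    n ∸ β                                     ≡⟨ ℕ-div.m≡m%n+[m/n]*n (n ∸ β) m ⟩
    ρ ℕ.+ μ ℕ.* m                             ≡⟨ ≡.cong (λ k → ρ ℕ.+ k ℕ.* m) h+i≡μ ⟨
    ρ ℕ.+ (h ℕ.+ i) ℕ.* m                     ≡⟨ lemma ρ h i m ⟩
    ρ ℕ.+ i ℕ.* m ℕ.+ h ℕ.* m                 ≡⟨ ≡.cong (λ k → ρ ℕ.+ i ℕ.* k ℕ.+ h ℕ.* m) pα≡m ⟨
    ρ ℕ.+ i ℕ.* (p ℕ.* α) ℕ.+ h ℕ.* m         ≡⟨ ≡.cong (λ k → ρ ℕ.+ k ℕ.+ h ℕ.* m) (ℕₚ.*-assoc i p α) ⟨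
    ρ ℕ.+ i ℕ.* p ℕ.* α ℕ.+ h ℕ.* m ∎)
    where
    lemma : ∀ ρ h i m → ρ ℕ.+ (h ℕ.+ i) ℕ.* m ≡ ρ ℕ.+ i ℕ.* m ℕ.+ h ℕ.* m
    lemma = solve-∀

  a≡ : a ≡ ρ ℕ./ α ℕ.+ i ℕ.* p
  a≡ = begin
    a                                         ≡⟨ ℕ-div.m*n/n≡m a α ⟨
    a ℕ.* α ℕ./ α                             ≡⟨ ≡.cong (ℕ._/ α) αa≡ ⟩
    (ρ ℕ.+ i ℕ.* p ℕ.* α) ℕ./ α               ≡⟨ ℕ-div.+-distrib-/-∣ʳ ρ (divides (i ℕ.* p) ≡.refl) ⟩
    ρ ℕ./ α ℕ.+ i ℕ.* p ℕ.* α ℕ./ α           ≡⟨ ≡.cong (ρ ℕ./ α ℕ.+_) (ℕ-div.m*n/n≡m (i ℕ.* p) α) ⟩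
    ρ ℕ./ α ℕ.+ i ℕ.* p ∎

-- From the expansion in f and g to the bound

module DoubleSum {c ℓ} (R : CommutativeRing c ℓ) where
  open CommutativeRing R
  open RingHelpers R
  open RingTools R

  sum₂ : ℕ → (ℕ → ℕ → Carrier) → Carrier
  sum₂ N t = sumTo N (λ a → sumTo N (t a))

  sum₂-cong : ∀ N {t u} → (∀ a b → t a b ≈ u a b) → sum₂ N t ≈ sum₂ N u
  sum₂-cong N e = sumTo-cong N (λ a → sumTo-cong N (e a))

  sum₂-0 : ∀ N {t} → (∀ a b → t a b ≈ 0#) → sum₂ N t ≈ 0#
  sum₂-0 N e = sumTo-0 N (λ a → sumTo-0 N (e a))

  sum₂-+ : ∀ N t u → sum₂ N t + sum₂ N u ≈ sum₂ N (λ a b → t a b + u a b)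
  sum₂-+ N t u = trans (sumTo-+ N _ _) (sumTo-cong N (λ a → sumTo-+ N (t a) (u a)))

  sum₂-*ˡ : ∀ N x t → x * sum₂ N t ≈ sum₂ N (λ a b → x * t a b)
  sum₂-*ˡ N x t = trans (sumTo-*ˡ N x _) (sumTo-cong N (λ a → sumTo-*ˡ N x (t a)))

module Bound {c ℓ} (K : AlgClosedFieldChar0 c ℓ) (κ′ p′ v′ c₁ c₂ C : ℕ) where
  open AlgClosedFieldChar0 K
  open Forms K
  open RingTools commRing
  open PowerSeries commRing
  open Representation K
  open Residue K κ′ p′ v′ c₁ c₂ C
  open DoubleSum commRing
  module S₂ = DoubleSum seriesRing
  open Relation.Binary.Reasoning.Setoid setoid

  private
    κ p v : ℕ
    κ = suc κ′
    p = suc p′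
    v = suc v′

  rep-sum₂ : ∀ N {t : ℕ → ℕ → Series} {h : ℕ → ℕ → Carrier → Carrier} → (∀ a b → Represents (t a b) (h a b)) →
             Represents (S₂.sum₂ N t) (λ y → sum₂ N (λ a b → h a b y))
  rep-sum₂ N r = rep-sumTo N (λ a → rep-sumTo N (r a))

  sum₂-coeff : ∀ N t n → S₂.sum₂ N t n ≈ sum₂ N (λ a b → t a b n)
  sum₂-coeff N t n = trans (sumTo-coeff N _ n) (sumTo-cong N (λ a → sumTo-coeff N (t a) n))

  -- The range is needed for homogeneity of forms: with truncated subtraction, `n ∸ suc j` and
  -- `suc j` add up to n only for j < n.
  sumTo-cong-< : ∀ N {f g : ℕ → Carrier} → (∀ i → i ℕ.< N → f i ≈ g i) → sumTo N f ≈ sumTo N g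
  sumTo-cong-< zero    e = refl
  sumTo-cong-< (suc N) e = +-cong (sumTo-cong-< N (λ i i<N → e i (ℕₚ.m<n⇒m<1+n i<N))) (e N ℕₚ.≤-refl)

  form-homogeneous : ∀ n A z x y → form n A (z * x) (z * y) ≈ pow z n * form n A x y
  form-homogeneous n A z x y = begin
    pow (z * x) n + sumTo n (λ j → A (suc j) * pow (z * x) (n ∸ suc j) * pow (z * y) (suc j))
      ≈⟨ +-cong (pow-distrib-* z x n) (sumTo-cong-< n term) ⟩
    pow z n * pow x n + sumTo n (λ j → pow z n * (A (suc j) * pow x (n ∸ suc j) * pow y (suc j)))
      ≈⟨ +-congˡ (sym (sumTo-*ˡ n (pow z n) _)) ⟩
    pow z n * pow x n + pow z n * sumTo n (λ j → A (suc j) * pow x (n ∸ suc j) * pow y (suc j))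
      ≈⟨ sym (distribˡ _ _ _) ⟩
    pow z n * form n A x y ∎
    where
    term : ∀ j → j ℕ.< n → A (suc j) * pow (z * x) (n ∸ suc j) * pow (z * y) (suc j)
                         ≈ pow z n * (A (suc j) * pow x (n ∸ suc j) * pow y (suc j))
    term j j<n = begin
      A (suc j) * pow (z * x) k * pow (z * y) l
        ≈⟨ *-cong (*-congˡ (pow-distrib-* z x k)) (pow-distrib-* z y l) ⟩
      A (suc j) * (pow z k * pow x k) * (pow z l * pow y l)
        ≈⟨ solve 5 (λ a zk xk zl yl → a :* (zk :* xk) :* (zl :* yl) := (zk :* zl) :* (a :* xk :* yl)) refl _ _ _ _ _ ⟩
      (pow z k * pow z l) * (A (suc j) * pow x k * pow y l)
        ≈⟨ *-congʳ (trans (sym (pow-+ z k l)) (reflexive (≡.cong (pow z) (ℕₚ.m∸n+n≡m j<n)))) ⟩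
      pow z n * (A (suc j) * pow x k * pow y l) ∎
      where
      k = n ∸ suc j
      l = suc j

  formSeries : ℕ → (ℕ → Carrier) → Series
  formSeries n A = S.pow S.1# n S.+ S.sumTo n (λ j → const (A (suc j)) S.* S.pow S.1# (n ∸ suc j) S.* S.pow X (suc j))

  rep-form : ∀ n A → Represents (formSeries n A) (λ y → form n A 1# y)
  rep-form n A = rep-+ (rep-pow n (rep-const 1#)) (rep-sumTo n (λ j →
    rep-* (rep-* (rep-const (A (suc j))) (rep-pow (n ∸ suc j) (rep-const 1#))) (rep-pow (suc j) rep-X)))

  formSeries-coeff : ∀ n d A → (∀ i → 1 ℕ.≤ i → i ℕ.< d → A i ≈ 0#) →
                     ∀ i → i ℕ.< d → formSeries n A i ≈ S.1# i
  formSeries-coeff n d A gap i i<d = trans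
    (+-cong (coeff (S.pow-1# n) i) (trans (sumTo-coeff n _ i) (sumTo-0 n term))) (+-identityʳ _)
    where
    monomial : ∀ j → A (suc j) * S.pow X (suc j) i ≈ 0#
    monomial j with suc j ℕ.≟ i
    ... | yes ≡.refl = trans (*-congʳ (gap (suc j) (s≤s z≤n) i<d)) (zeroˡ _)
    ... | no  j≢i    = trans (*-congˡ (X^-offdiag (suc j) i j≢i)) (zeroʳ _)
    term : ∀ j → (const (A (suc j)) S.* S.pow S.1# (n ∸ suc j) S.* S.pow X (suc j)) i ≈ 0#
    term j = trans
      (coeff (S.*-congʳ {S.pow X (suc j)} (S.trans (S.*-congˡ {const (A (suc j))} (S.pow-1# (n ∸ suc j))) (S.*-identityʳ _))) i)
                   (trans (const-⊛ (A (suc j)) (S.pow X (suc j)) i) (monomial j))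

  double-0 : ∀ {x} → x ≈ - x → x ≈ 0#
  double-0 {x} e = *-cancelˡ-0# (char0 1)
    (trans (solve 1 (λ x → :cast 2 :* x := x :+ x) refl x) (trans (+-congˡ e) (-‿inverseʳ x)))

  pow-neg-even : ∀ x h → pow (- x) (h ℕ.* 2) ≈ pow x (h ℕ.* 2)
  pow-neg-even x h = trans (pow-* (- x) h 2) (trans (pow-cong h (solve 1 (λ x → (:- x) :↑ 2 := x :↑ 2) refl x)) (sym (pow-* x h 2)))

  oddPart : ℕ → Carrier → Carrier
  oddPart b x with parity b
  ... | inj₁ _ = 0#
  ... | inj₂ _ = x

  -- Removing twice the odd part leaves the term after g ↦ -g, that is, after the MacWilliams
  -- transform.
  pow-oddPart : ∀ b c x y → c * x * pow y b ≈ c * x * pow (- y) b + cast 2 * (oddPart b c * x * pow y b)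
  pow-oddPart b c x y with parity b
  ... | inj₁ (h , ≡.refl) = trans (*-congˡ (sym (pow-neg-even y h)))
    (solve 4 (λ c x p q → c :* x :* p := c :* x :* p :+ :cast 2 :* (:cast 0 :* x :* q)) refl c x (pow (- y) (h ℕ.* 2)) (pow y (h ℕ.* 2)))
  ... | inj₂ (h , ≡.refl) = trans
    (solve 4 (λ c x y q → c :* x :* (y :* q) := c :* x :* (:- y :* q) :+ :cast 2 :* (c :* x :* (y :* q))) refl c x y (pow y (h ℕ.* 2)))
    (+-congʳ (*-congˡ (*-congˡ (sym (pow-neg-even y h)))))

  oddPart-*-0 : ∀ b {c x} → (∀ h → b ≡ suc (h ℕ.* 2) → x ≈ 0#) → oddPart b c * x ≈ 0#
  oddPart-*-0 b z with parity b
  ... | inj₁ _       = zeroˡ _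
  ... | inj₂ (h , e) = trans (*-congˡ (z h e)) (zeroʳ _)

  -- The sign ε in `g-invariant` reflects that q r² = 1 leaves the sign of r open, which matters
  -- when the degree β of g is odd.
  module _ (α′ β′ : ℕ) (pα≡2β : suc p′ ℕ.* suc α′ ≡ 2 ℕ.* suc β′)
    (G : Series)
    (syzygy     : S.pow G 2 S.+ S.cast C S.* (U S.* S.pow (S.1# S.- U) v) S.≈ S.pow F p)
    (derivative : S.cast p S.* (F′ S.* (S.1# S.- U)) S.+ S.cast v S.* (U S.* F) S.+ G S.≈ F S.* (S.1# S.- U))
    (q : ℕ) (f g : BinForm)
    (f-homogeneous : ∀ z x y → f (z * x) (z * y) ≈ pow z (suc α′) * f x y)
    (g-homogeneous : ∀ z x y → g (z * x) (z * y) ≈ pow z (suc β′) * g x y)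
    (rep-f : Represents F (λ y → f 1# y))
    (rep-g : Represents G (λ y → g 1# y))
    (f-invariant : ∀ r → cast q * (r * r) ≈ 1# → ∀ x y → transform r (r * cast (q ∸ 1)) r (- r) f x y ≈ f x y)
    (g-invariant : ∀ r → cast q * (r * r) ≈ 1# → ∃ λ ε → ε * ε ≈ 1# ×
                   (∀ x y → transform r (r * cast (q ∸ 1)) r (- r) g x y ≈ - (ε * g x y)))
    where
    open Vanishing G syzygy derivative

    private
      α β m : ℕ
      α = suc α′
      β = suc β′
      m = 2 ℕ.* β

    module _ (r : Carrier) (qr²≈1 : cast q * (r * r) ≈ 1#)
      (n d : ℕ) (A : ℕ → Carrier) (1≤d : 1 ℕ.≤ d)
      (gap : ∀ i → 1 ℕ.≤ i → i ℕ.< d → A i ≈ 0#)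
      (isFWE : IsFormalWE q r (form n A))
      (N : ℕ) (coef : ℕ → ℕ → Carrier)
      (expansion : ∀ x y → form n A x y ≈ sum₂ N (λ a b → coef a b * pow (f x y) a * pow (g x y) b))
      where

      W : Series
      W = formSeries n A

      W₀≈1 : W 0 ≈ 1#
      W₀≈1 = formSeries-coeff n d A gap 0 1≤d

      σ : BinForm → BinForm
      σ = transform r (r * cast (q ∸ 1)) r (- r)

      -- If both generators were fixed, so would be W; with σW = -W this gives W = 0, against the
      -- leading coefficient 1.
      g-not-invariant : ¬ (∀ x y → σ g x y ≈ g x y)
      g-not-invariant σg≈g = nontrivial (trans (sym W₀≈1) (rep-0 (rep-form n A) (λ y → vanish 1# y) 0))
        where
        vanish : ∀ x y → form n A x y ≈ 0#
        vanish x y = double-0 (begin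
          form n A x y                                                       ≈⟨ expansion x y ⟩
          sum₂ N (λ a b → coef a b * pow (f x y) a * pow (g x y) b)
            ≈⟨ sum₂-cong N (λ a b → *-cong (*-congˡ (pow-cong a (sym (f-invariant r qr²≈1 x y)))) (pow-cong b (sym (σg≈g x y)))) ⟩
          sum₂ N (λ a b → coef a b * pow (σ f x y) a * pow (σ g x y) b)      ≈⟨ sym (expansion _ _) ⟩
          σ (form n A) x y                                                   ≈⟨ isFWE x y ⟩
          - form n A x y ∎)

      -- Equality in the field is not decidable, so the sign ε = ±1 is only known up to double negation.
      g-not-not-negated : ¬ ¬ (∀ x y → σ g x y ≈ - g x y)
      g-not-not-negated ¬neg with g-invariant r qr²≈1
      ... | ε , ε²≈1 , σg≈-εg = g-not-invariant (λ x y → begin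
        σ g x y                         ≈⟨ σg≈-εg x y ⟩
        - (ε * g x y)                   ≈⟨ solve 2 (λ ε t → :- (ε :* t) := t :- (ε :+ t :^ 0) :* t) refl ε (g x y) ⟩
        g x y - (ε + 1#) * g x y        ≈⟨ +-congˡ (-‿cong (trans (*-congʳ ε+1≈0) (zeroˡ _))) ⟩
        g x y - 0#                      ≈⟨ solve 1 (λ t → t :- :cast 0 := t) refl (g x y) ⟩
        g x y ∎)
        where
        ε-1≉0 : ¬ (ε - 1# ≈ 0#)
        ε-1≉0 e = ¬neg (λ x y → trans (σg≈-εg x y) (-‿cong (trans (*-congʳ (x-y≈0⇒x≈y e)) (*-identityˡ _))))
        ε+1≈0 : ε + 1# ≈ 0#
        ε+1≈0 = *-cancelˡ-0# ε-1≉0 (trans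
          (solve 1 (λ ε → (ε :- ε :^ 0) :* (ε :+ ε :^ 0) := ε :* ε :- ε :^ 0) refl ε)
          (trans (+-congʳ ε²≈1) (-‿inverseʳ 1#)))

      module _ (σg≈-g : ∀ x y → σ g x y ≈ - g x y) where

        -- With o the odd part, expanding W at the transformed point gives w = -w + 2o, hence 2(w -
        -- o) = 0.
        odd-expansion : ∀ x y → form n A x y ≈ sum₂ N (λ a b → oddPart b (coef a b) * pow (f x y) a * pow (g x y) b)
        odd-expansion x y = x-y≈0⇒x≈y (double-0 (begin
          w - o                          ≈⟨ +-congʳ w≈ ⟩
          (- w + cast 2 * o) - o         ≈⟨ solve 2 (λ w o → (:- w :+ :cast 2 :* o) :- o := :- (w :- o)) refl w o ⟩
          - (w - o) ∎))
          where
          w = form n A x y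
          odd negated : ℕ → ℕ → Carrier
          odd a b = oddPart b (coef a b) * pow (f x y) a * pow (g x y) b
          negated a b = coef a b * pow (f x y) a * pow (- g x y) b
          o = sum₂ N odd
          w≈ : w ≈ - w + cast 2 * o
          w≈ = begin
            w
              ≈⟨ expansion x y ⟩
            sum₂ N (λ a b → coef a b * pow (f x y) a * pow (g x y) b)
              ≈⟨ sum₂-cong N (λ a b → pow-oddPart b (coef a b) (pow (f x y) a) (g x y)) ⟩
            sum₂ N (λ a b → negated a b + cast 2 * odd a b)
              ≈⟨ sym (sum₂-+ N _ _) ⟩
            sum₂ N negated + sum₂ N (λ a b → cast 2 * odd a b)
              ≈⟨ +-cong (sum₂-cong N (λ a b →
                         *-cong (*-congˡ (pow-cong a (sym (f-invariant r qr²≈1 x y)))) (pow-cong b (sym (σg≈-g x y)))))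
                        (sym (sum₂-*ˡ N (cast 2) _)) ⟩
            sum₂ N (λ a b → coef a b * pow (σ f x y) a * pow (σ g x y) b) + cast 2 * o
              ≈⟨ +-congʳ (trans (sym (expansion _ _)) (isFWE x y)) ⟩
            - w + cast 2 * o ∎

        degree : ℕ → ℕ → ℕ
        degree a b = α ℕ.* a ℕ.+ β ℕ.* b

        -- The second factor is a Kronecker delta of `degree a b` and n, in the shape in which it
        -- arises from comparing coefficients of zⁿ. It discards the parts of the expansion in other
        -- degrees.
        term : ℕ → ℕ → Carrier
        term a b = oddPart b (coef a b) * S.pow X (degree a b) n

        -- Compare coefficients of zⁿ in W(z, zy).
        homogeneous-expansion : ∀ y → form n A 1# y ≈ sum₂ N (λ a b → term a b * pow (f 1# y) a * pow (g 1# y) b)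
        homogeneous-expansion y = begin
          w
            ≈⟨ sym (trans (const-⊛ w (S.pow X n) n) (trans (*-congˡ (X^-diag n)) (*-identityʳ w))) ⟩
          (const w S.* S.pow X n) n
            ≈⟨ coeff (rep-unique lhs rhs agree) n ⟩
          S₂.sum₂ N (λ a b → const (t a b) S.* S.pow X (degree a b)) n
            ≈⟨ sum₂-coeff N _ n ⟩
          sum₂ N (λ a b → (const (t a b) S.* S.pow X (degree a b)) n)
            ≈⟨ sum₂-cong N (λ a b → trans (const-⊛ (t a b) _ n)
                 (solve 4 (λ o f g δ → o :* f :* g :* δ := o :* δ :* f :* g) refl
                   (oddPart b (coef a b)) (pow (f 1# y) a) (pow (g 1# y) b) (S.pow X (degree a b) n))) ⟩
          sum₂ N (λ a b → term a b * pow (f 1# y) a * pow (g 1# y) b) ∎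
          where
          w = form n A 1# y
          t : ℕ → ℕ → Carrier
          t a b = oddPart b (coef a b) * pow (f 1# y) a * pow (g 1# y) b
          lhs : Represents (const w S.* S.pow X n) (λ z → w * pow z n)
          lhs = rep-* (rep-const w) (rep-pow n rep-X)
          rhs : Represents (S₂.sum₂ N (λ a b → const (t a b) S.* S.pow X (degree a b)))
                           (λ z → sum₂ N (λ a b → t a b * pow z (degree a b)))
          rhs = rep-sum₂ N (λ a b → rep-* (rep-const (t a b)) (rep-pow (degree a b) rep-X))
          power : ∀ z k j x → pow (pow z k * x) j ≈ pow z (k ℕ.* j) * pow x j
          power z k j x = trans (pow-distrib-* (pow z k) x j)
            (*-congʳ (trans (sym (pow-* z j k)) (reflexive (≡.cong (pow z) (ℕₚ.*-comm j k)))))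
          agree : ∀ z → w * pow z n ≈ sum₂ N (λ a b → t a b * pow z (degree a b))
          agree z = begin
            w * pow z n                        ≈⟨ *-comm _ _ ⟩
            pow z n * w                        ≈⟨ sym (form-homogeneous n A z 1# y) ⟩
            form n A (z * 1#) (z * y)          ≈⟨ odd-expansion _ _ ⟩
            sum₂ N (λ a b → oddPart b (coef a b) * pow (f (z * 1#) (z * y)) a * pow (g (z * 1#) (z * y)) b)
              ≈⟨ sum₂-cong N (λ a b → begin
                oddPart b (coef a b) * pow (f (z * 1#) (z * y)) a * pow (g (z * 1#) (z * y)) b
                  ≈⟨ *-cong (*-congˡ (trans (pow-cong a (f-homogeneous z 1# y)) (power z α a _)))
                            (trans (pow-cong b (g-homogeneous z 1# y)) (power z β b _)) ⟩
                oddPart b (coef a b) * (pow z (α ℕ.* a) * pow (f 1# y) a) * (pow z (β ℕ.* b) * pow (g 1# y) b)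
                  ≈⟨ solve 5 (λ o x f y g → o :* (x :* f) :* (y :* g) := (o :* f :* g) :* (x :* y)) refl _ _ _ _ _ ⟩
                t a b * (pow z (α ℕ.* a) * pow z (β ℕ.* b))
                  ≈⟨ *-congˡ (sym (pow-+ z (α ℕ.* a) (β ℕ.* b))) ⟩
                t a b * pow z (degree a b) ∎) ⟩
            sum₂ N (λ a b → t a b * pow z (degree a b)) ∎

        W-expansion : W S.≈ S₂.sum₂ N (λ a b → const (term a b) S.* (S.pow F a S.* S.pow G b))
        W-expansion = rep-unique (rep-form n A)
          (rep-sum₂ N (λ a b → rep-* (rep-const (term a b)) (rep-* (rep-pow a rep-f) (rep-pow b rep-g))))
          (λ y → trans (homogeneous-expansion y) (sum₂-cong N (λ a b → *-assoc _ _ _)))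

        W-coeff : ∀ M k → (W S.* M) k ≈ sum₂ N (λ a b → term a b * (S.pow F a S.* S.pow G b S.* M) k)
        W-coeff M k = begin
          (W S.* M) k
            ≈⟨ coeff (S.trans (S.*-comm W M) (S.trans (S.*-congˡ {M} W-expansion) (S₂.sum₂-*ˡ N M _))) k ⟩
          S₂.sum₂ N (λ a b → M S.* (const (term a b) S.* (S.pow F a S.* S.pow G b))) k
            ≈⟨ sum₂-coeff N _ k ⟩
          sum₂ N (λ a b → (M S.* (const (term a b) S.* (S.pow F a S.* S.pow G b))) k)
            ≈⟨ sum₂-cong N (λ a b → trans
                 (coeff (S.solve 3 (λ m x y → m S.:* (x S.:* y) S.:= x S.:* (y S.:* m)) S.refl
                   M (const (term a b)) (S.pow F a S.* S.pow G b)) k)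
                 (const-⊛ (term a b) _ k)) ⟩
          sum₂ N (λ a b → term a b * (S.pow F a S.* S.pow G b S.* M) k) ∎

        term-*-0 : ∀ a b x → (∀ h → b ≡ suc (h ℕ.* 2) → degree a b ≡ n → x ≈ 0#) → term a b * x ≈ 0#
        term-*-0 a b x z = trans (*-assoc _ _ _) (oddPart-*-0 b odd)
          where
          odd : ∀ h → b ≡ suc (h ℕ.* 2) → S.pow X (degree a b) n * x ≈ 0#
          odd h e with degree a b ℕ.≟ n
          ... | yes deg = trans (*-congˡ (z h e deg)) (zeroʳ _)
          ... | no ¬deg = trans (*-congʳ (X^-offdiag (degree a b) n ¬deg)) (zeroˡ _)

        -- A surviving monomial contains g at least once. This makes `n ∸ β` a true difference, so
        -- that the floor in the theorem is taken of a nonnegative number.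
        n≮β : ¬ (n ℕ.< β)
        n≮β n<β = nontrivial (begin
          1#                  ≈⟨ sym W₀≈1 ⟩
          W 0                 ≈⟨ sym (coeff (S.*-identityʳ W) 0) ⟩
          (W S.* S.1#) 0      ≈⟨ W-coeff S.1# 0 ⟩
          sum₂ N (λ a b → term a b * (S.pow F a S.* S.pow G b S.* S.1#) 0)
                              ≈⟨ sum₂-0 N (λ a b → term-*-0 a b _ (λ h e deg → contradiction n<β (ℕₚ.≤⇒≯ (β≤ a b h e deg)))) ⟩
          0# ∎)
          where
          β≤ : ∀ a b h → b ≡ suc (h ℕ.* 2) → degree a b ≡ n → β ℕ.≤ n
          β≤ a .(suc (h ℕ.* 2)) h ≡.refl ≡.refl = ℕₚ.≤-trans (ℕₚ.m≤m*n β (suc (h ℕ.* 2))) (ℕₚ.m≤n+m _ (α ℕ.* a))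

        bound : ¬ (κ ℕ.* ((n ∸ β) ℕ./ m) ℕ.+ κ ℕ.< d)
        bound κμ+κ<d = char0 (proj₁ positive) (begin
          cast (suc (proj₁ positive))                     ≈⟨ sym (proj₂ positive) ⟩
          M (suc l)                                       ≈⟨ sym (*-identityˡ _) ⟩
          1# * M (suc l)                                  ≈⟨ sym (+-identityʳ _) ⟩
          1# * M (suc l) + 0#                             ≈⟨ +-cong (*-congʳ (sym W₀≈1)) (sym (⊛-zero (tail W) M l low)) ⟩
          (W S.* M) (suc l)                               ≈⟨ W-coeff M (suc l) ⟩
          sum₂ N (λ a b → term a b * (S.pow F a S.* S.pow G b S.* M) (suc l))
                                                          ≈⟨ sum₂-0 N (λ a b → term-*-0 a b _ (vanishing a b)) ⟩
          0# ∎)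
          where
          μ e l : ℕ
          μ = (n ∸ β) ℕ./ m
          e = ((n ∸ β) % m) ℕ./ α
          -- `suc l` is κ(μ + 1) by computation; in successor form the product unfolds to W₀ M(suc
          -- l) plus terms in the coefficients W₁, ..., W at `suc l`, all zero when κ(μ + 1) < d.
          l = κ′ ℕ.+ μ ℕ.* κ
          M : Series
          M = multiplier e μ
          positive : IsPos (M (suc l))
          positive = proj₂ (Positiveκ-multiplier (p′ ∸ e) μ) (suc μ)
          l<d : suc l ℕ.< d
          l<d = ≡.subst (ℕ._< d) (≡.trans (ℕₚ.+-comm (κ ℕ.* μ) κ) (≡.cong (κ ℕ.+_) (ℕₚ.*-comm κ μ))) κμ+κ<d
          low : ∀ i → i ℕ.≤ l → tail W i ≈ 0#
          low i i≤l = formSeries-coeff n d A gap (suc i) (ℕₚ.≤-<-trans (s≤s i≤l) l<d)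
          -- From ρ < 2β = pα: the exponent p - 1 - e of F in M is not truncated.
          e≤p′ : e ℕ.≤ p′
          e≤p′ = ℕₚ.≤-pred (ℕ-div.m<n*o⇒m/o<n (≡.subst ((n ∸ β) % m ℕ.<_) (≡.sym pα≡2β) (ℕ-div.m%n<n (n ∸ β) m)))
          vanishing : ∀ a b h → b ≡ suc (h ℕ.* 2) → degree a b ≡ n → (S.pow F a S.* S.pow G b S.* M) (suc l) ≈ 0#
          vanishing a .(suc (h ℕ.* 2)) h ≡.refl deg with exponents α β p n a h pα≡2β deg
          ... | i , h+i≡μ , a≡ = ≡.subst₂ (λ a μ → (S.pow F a S.* S.pow G (suc (h ℕ.* 2)) S.* multiplier e μ) (suc μ ℕ.* κ) ≈ 0#)
                                   (≡.sym a≡) h+i≡μ (term-coeff e h i e≤p′)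

    minDistBound : MinDistBound q f g κ β m
    minDistBound r qr²≈1 n d A 1≤d _ gap _ isFWE (N , coef , expansion)
      -- Both questions are decidable in ℕ, so the two bad cases only have to be refuted, and for
      -- that the doubly negated sign of g suffices.
      with n ℕ.<? β | d ℕ.≤? κ ℕ.* ((n ∸ β) ℕ./ m) ℕ.+ κ
    ... | no n≮β  | yes d≤ = ≡.subst (+ d ℤ.≤_) (≡.sym floor) (ℤ.+≤+ d≤)
      where
      μ : ℕ
      μ = (n ∸ β) ℕ./ m
      floor : + κ ℤ.* (((+ n) ℤ.- (+ β)) /ℕ m) ℤ.+ + κ ≡ + (κ ℕ.* μ ℕ.+ κ)
      floor = ≡.cong (ℤ._+ + κ) (≡.trans
        (≡.cong (λ i → + κ ℤ.* (i /ℕ m)) (≡.trans (ℤₚ.m-n≡m⊖n n β) (ℤₚ.⊖-≥ (ℕₚ.≮⇒≥ n≮β))))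
        (≡.sym (ℤₚ.pos-* κ μ)))
    ... | yes n<β | _      = contradiction (λ σg≈-g → n≮β r qr²≈1 n d A 1≤d gap isFWE N coef expansion σg≈-g n<β)
                               (g-not-not-negated r qr²≈1 n d A 1≤d gap isFWE N coef expansion)
    ... | no n≮β  | no d≰  = contradiction (λ σg≈-g → bound r qr²≈1 n d A 1≤d gap isFWE N coef expansion σg≈-g (ℕₚ.≰⇒> d≰))
                               (g-not-not-negated r qr²≈1 n d A 1≤d gap isFWE N coef expansion)

-- The four types

module FourTypes {c ℓ} (K : AlgClosedFieldChar0 c ℓ) where
  open AlgClosedFieldChar0 K
  open Forms K
  open RingTools commRing
  open PowerSeries commRing
  open Representation K

  rep-U : ∀ κ → Represents (S.pow X κ) (λ y → pow y κ)
  rep-U κ = rep-pow κ rep-X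

  rep-F : ∀ κ c₁ c₂ → Represents (S.1# S.+ S.cast c₁ S.* S.pow X κ S.+ S.cast c₂ S.* (S.pow X κ S.* S.pow X κ))
                                 (λ y → 1# + cast c₁ * pow y κ + cast c₂ * (pow y κ * pow y κ))
  rep-F κ c₁ c₂ = rep-+ (rep-+ (rep-const 1#) (rep-* (rep-cast c₁) (rep-U κ))) (rep-* (rep-cast c₂) (rep-* (rep-U κ) (rep-U κ)))

  module _ (q : ℕ) (r : Carrier) (qr²≈1 : cast q * (r * r) ≈ 1#) where

    unscale : ∀ k x → pow (cast q * (r * r)) k * x ≈ x
    unscale k x = trans (*-congʳ (trans (pow-cong k qr²≈1) (pow-1# k))) (*-identityˡ x)

    -- The factor `1#` is ε: if g has even degree, r enters only through r².
    unscale-neg : ∀ k x → - (pow (cast q * (r * r)) k * x) ≈ - (1# * x)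
    unscale-neg k x = -‿cong (trans (unscale k x) (sym (*-identityˡ x)))

  private
    :F₁ : ∀ {n} → ℕ → ℕ → Polynomial n → Polynomial n
    :F₁ c₁ c₂ u = u :^ 0 :+ :cast c₁ :* u :+ :cast c₂ :* (u :* u)

    :F :F′ : ∀ {n} → ℕ → ℕ → S.Polynomial n → S.Polynomial n
    :F  c₁ c₂ u = u S.:^ 0 S.:+ S.:cast c₁ S.:* u S.:+ S.:cast c₂ S.:* (u S.:* u)
    :F′ c₁ c₂ u = S.:cast c₁ S.:* u S.:+ S.:cast (2 ℕ.* c₂) S.:* (u S.:* u)

  -- Here F² - G = 8U and F² + G = 2(1 - U)², whence p = 4 and C = 16. Primed arguments of `Bound`
  -- are one less than the quantities κ, p, v, α, β.
  typeI : MinDistBound 2 (W2 2) φ4 2 4 8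
  typeI = Bound.minDistBound K 1 3 1 1 0 16 1 3 ≡.refl G
    (S.solve 1 (λ u →
       :G u S.:↑ 2 S.:+ S.:cast 16 S.:* (u S.:* (u S.:^ 0 S.:- u) S.:↑ 2) S.:= :F 1 0 u S.:↑ 4) S.refl U)
    (S.solve 1 (λ u →
       S.:cast 4 S.:* (:F′ 1 0 u S.:* (u S.:^ 0 S.:- u)) S.:+ S.:cast 2 S.:* (u S.:* :F 1 0 u) S.:+ :G u
       S.:= :F 1 0 u S.:* (u S.:^ 0 S.:- u)) S.refl U)
    2 (W2 2) φ4
    (solve 3 (λ z x y → f (z :* x) (z :* y) := z :↑ 2 :* f x y) refl)
    (solve 3 (λ z x y → g (z :* x) (z :* y) := z :↑ 4 :* g x y) refl)
    (rep-cong S.refl (solve 1 (λ y → f (y :^ 0) y := :F₁ 1 0 (y :↑ 2)) refl) (rep-F 2 1 0))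
    (rep-cong S.refl (solve 1 (λ y → let u = y :↑ 2 in g (y :^ 0) y := u :^ 0 :- :cast 6 :* u :+ u :* u) refl)
      (rep-+ (rep-+ (rep-const 1#) (rep-neg (rep-* (rep-cast 6) (rep-U 2)))) (rep-* (rep-U 2) (rep-U 2))))
    (λ r qr²≈1 x y → trans
      -- Homogeneity pulls out r^α; the unscaled matrix has square q, and multiplies f by q^(α/2).
      (solve 3 (λ r x y → f (r :* x :+ r :* :cast 1 :* y) (r :* x :+ :- r :* y) := (:cast 2 :* (r :* r)) :↑ 1 :* f x y) refl r x y)
      (unscale 2 r qr²≈1 1 (W2 2 x y)))
    (λ r qr²≈1 → 1# , *-identityˡ 1# , λ x y → trans
      (solve 3 (λ r x y → g (r :* x :+ r :* :cast 1 :* y) (r :* x :+ :- r :* y) := :- ((:cast 2 :* (r :* r)) :↑ 2 :* g x y)) refl r x y)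
      (unscale-neg 2 r qr²≈1 2 (φ4 x y)))
    where
    U G : Series
    U = S.pow X 2
    G = S.1# S.- S.cast 6 S.* U S.+ U S.* U
    :G : ∀ {n} → S.Polynomial n → S.Polynomial n
    :G u = u S.:^ 0 S.:- S.:cast 6 S.:* u S.:+ u S.:* u
    f g : ∀ {n} → Polynomial n → Polynomial n → Polynomial n
    f x y = x :↑ 2 :+ :cast 1 :* y :↑ 2
    g x y = x :↑ 4 :- :cast 6 :* x :↑ 2 :* y :↑ 2 :+ y :↑ 4

  -- The syzygy f³ - g² = 108 x⁴y⁴(x⁴ - y⁴)⁴ is the counterpart of E₄³ - E₆² = 1728 Δ for modular
  -- forms.
  typeII : MinDistBound 2 WH8 W12 4 12 24
  typeII = Bound.minDistBound K 3 2 3 14 1 108 7 11 ≡.refl G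
    (S.solve 1 (λ u →
       :G u S.:↑ 2 S.:+ S.:cast 108 S.:* (u S.:* (u S.:^ 0 S.:- u) S.:↑ 4) S.:= :F 14 1 u S.:↑ 3) S.refl U)
    (S.solve 1 (λ u →
       S.:cast 3 S.:* (:F′ 14 1 u S.:* (u S.:^ 0 S.:- u)) S.:+ S.:cast 4 S.:* (u S.:* :F 14 1 u) S.:+ :G u
       S.:= :F 14 1 u S.:* (u S.:^ 0 S.:- u)) S.refl U)
    2 WH8 W12
    (solve 3 (λ z x y → f (z :* x) (z :* y) := z :↑ 8 :* f x y) refl)
    (solve 3 (λ z x y → g (z :* x) (z :* y) := z :↑ 12 :* g x y) refl)
    (rep-cong S.refl (solve 1 (λ y → f (y :^ 0) y := :F₁ 14 1 (y :↑ 4)) refl) (rep-F 4 14 1))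
    (rep-cong S.refl (solve 1 (λ y → let u = y :↑ 4 in g (y :^ 0) y
        := u :^ 0 :- :cast 33 :* u :- :cast 33 :* (u :* u) :+ u :* (u :* u)) refl)
      (rep-+ (rep-+ (rep-+ (rep-const 1#) (rep-neg (rep-* (rep-cast 33) (rep-U 4))))
        (rep-neg (rep-* (rep-cast 33) (rep-* (rep-U 4) (rep-U 4)))))
        (rep-* (rep-U 4) (rep-* (rep-U 4) (rep-U 4)))))
    (λ r qr²≈1 x y → trans
      (solve 3 (λ r x y → f (r :* x :+ r :* :cast 1 :* y) (r :* x :+ :- r :* y) := (:cast 2 :* (r :* r)) :↑ 4 :* f x y) refl r x y)
      (unscale 2 r qr²≈1 4 (WH8 x y)))
    (λ r qr²≈1 → 1# , *-identityˡ 1# , λ x y → trans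
      (solve 3 (λ r x y → g (r :* x :+ r :* :cast 1 :* y) (r :* x :+ :- r :* y) := :- ((:cast 2 :* (r :* r)) :↑ 6 :* g x y)) refl r x y)
      (unscale-neg 2 r qr²≈1 6 (W12 x y)))
    where
    U G : Series
    U = S.pow X 4
    G = S.1# S.- S.cast 33 S.* U S.- S.cast 33 S.* (U S.* U) S.+ U S.* (U S.* U)
    :G : ∀ {n} → S.Polynomial n → S.Polynomial n
    :G u = u S.:^ 0 S.:- S.:cast 33 S.:* u S.:- S.:cast 33 S.:* (u S.:* u) S.:+ u S.:* (u S.:* u)
    f g : ∀ {n} → Polynomial n → Polynomial n → Polynomial n
    f x y = x :↑ 8 :+ :cast 14 :* x :↑ 4 :* y :↑ 4 :+ y :↑ 8
    g x y = x :↑ 12 :- :cast 33 :* x :↑ 8 :* y :↑ 4 :- :cast 33 :* x :↑ 4 :* y :↑ 8 :+ y :↑ 12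

  -- In homogeneous form the syzygy is f³ - g² = 64 y³(x³ - y³)³; the constant 64 = 3·8 + 2·20 can
  -- be read off at U.
  typeIII : MinDistBound 3 W4 ψ6 3 6 12
  typeIII = Bound.minDistBound K 2 2 2 8 0 64 3 5 ≡.refl G
    (S.solve 1 (λ u →
       :G u S.:↑ 2 S.:+ S.:cast 64 S.:* (u S.:* (u S.:^ 0 S.:- u) S.:↑ 3) S.:= :F 8 0 u S.:↑ 3) S.refl U)
    (S.solve 1 (λ u →
       S.:cast 3 S.:* (:F′ 8 0 u S.:* (u S.:^ 0 S.:- u)) S.:+ S.:cast 3 S.:* (u S.:* :F 8 0 u) S.:+ :G u
       S.:= :F 8 0 u S.:* (u S.:^ 0 S.:- u)) S.refl U)
    3 W4 ψ6
    (solve 3 (λ z x y → f (z :* x) (z :* y) := z :↑ 4 :* f x y) refl)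
    (solve 3 (λ z x y → g (z :* x) (z :* y) := z :↑ 6 :* g x y) refl)
    (rep-cong S.refl (solve 1 (λ y → f (y :^ 0) y := :F₁ 8 0 (y :↑ 3)) refl) (rep-F 3 8 0))
    (rep-cong S.refl (solve 1 (λ y → let u = y :↑ 3 in g (y :^ 0) y := u :^ 0 :- :cast 20 :* u :- :cast 8 :* (u :* u)) refl)
      (rep-+ (rep-+ (rep-const 1#) (rep-neg (rep-* (rep-cast 20) (rep-U 3)))) (rep-neg (rep-* (rep-cast 8) (rep-* (rep-U 3) (rep-U 3))))))
    (λ r qr²≈1 x y → trans
      (solve 3 (λ r x y → f (r :* x :+ r :* :cast 2 :* y) (r :* x :+ :- r :* y) := (:cast 3 :* (r :* r)) :↑ 2 :* f x y) refl r x y)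
      (unscale 3 r qr²≈1 2 (W4 x y)))
    (λ r qr²≈1 → 1# , *-identityˡ 1# , λ x y → trans
      (solve 3 (λ r x y → g (r :* x :+ r :* :cast 2 :* y) (r :* x :+ :- r :* y) := :- ((:cast 3 :* (r :* r)) :↑ 3 :* g x y)) refl r x y)
      (unscale-neg 3 r qr²≈1 3 (ψ6 x y)))
    where
    U G : Series
    U = S.pow X 3
    G = S.1# S.- S.cast 20 S.* U S.- S.cast 8 S.* (U S.* U)
    :G : ∀ {n} → S.Polynomial n → S.Polynomial n
    :G u = u S.:^ 0 S.:- S.:cast 20 S.:* u S.:- S.:cast 8 S.:* (u S.:* u)
    f g : ∀ {n} → Polynomial n → Polynomial n → Polynomial n
    f x y = x :↑ 4 :+ :cast 8 :* x :* y :↑ 3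
    g x y = x :↑ 6 :- :cast 20 :* x :↑ 3 :* y :↑ 3 :- :cast 8 :* y :↑ 6

  -- Since g has degree 3, the transform multiplies it by -8r³ = -(4r²)(2r). Hence ε = 2r, whose
  -- square is 4r² = 1; this is the one type where ε may be -1.
  typeIV : MinDistBound 4 (W2 4) φ3 2 3 6
  typeIV = Bound.minDistBound K 1 2 1 3 0 27 1 2 ≡.refl G
    (S.solve 1 (λ u →
       :G u S.:↑ 2 S.:+ S.:cast 27 S.:* (u S.:* (u S.:^ 0 S.:- u) S.:↑ 2) S.:= :F 3 0 u S.:↑ 3) S.refl U)
    (S.solve 1 (λ u →
       S.:cast 3 S.:* (:F′ 3 0 u S.:* (u S.:^ 0 S.:- u)) S.:+ S.:cast 2 S.:* (u S.:* :F 3 0 u) S.:+ :G u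
       S.:= :F 3 0 u S.:* (u S.:^ 0 S.:- u)) S.refl U)
    4 (W2 4) φ3
    (solve 3 (λ z x y → f (z :* x) (z :* y) := z :↑ 2 :* f x y) refl)
    (solve 3 (λ z x y → g (z :* x) (z :* y) := z :↑ 3 :* g x y) refl)
    (rep-cong S.refl (solve 1 (λ y → f (y :^ 0) y := :F₁ 3 0 (y :↑ 2)) refl) (rep-F 2 3 0))
    (rep-cong S.refl (solve 1 (λ y → let u = y :↑ 2 in g (y :^ 0) y := u :^ 0 :- :cast 9 :* u) refl)
      (rep-+ (rep-const 1#) (rep-neg (rep-* (rep-cast 9) (rep-U 2)))))
    (λ r qr²≈1 x y → trans
      (solve 3 (λ r x y → f (r :* x :+ r :* :cast 3 :* y) (r :* x :+ :- r :* y) := (:cast 4 :* (r :* r)) :↑ 1 :* f x y) refl r x y)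
      (unscale 4 r qr²≈1 1 (W2 4 x y)))
    (λ r qr²≈1 → cast 2 * r , trans (solve 1 (λ r → (:cast 2 :* r) :* (:cast 2 :* r) := :cast 4 :* (r :* r)) refl r) qr²≈1 , λ x y → trans
      (solve 3 (λ r x y → g (r :* x :+ r :* :cast 3 :* y) (r :* x :+ :- r :* y)
                          := :- ((:cast 4 :* (r :* r)) :↑ 1 :* (:cast 2 :* r :* g x y))) refl r x y)
      (-‿cong (unscale 4 r qr²≈1 1 (cast 2 * r * φ3 x y))))
    where
    U G : Series
    U = S.pow X 2
    G = S.1# S.- S.cast 9 S.* U
    :G : ∀ {n} → S.Polynomial n → S.Polynomial n
    :G u = u S.:^ 0 S.:- S.:cast 9 S.:* u
    f g : ∀ {n} → Polynomial n → Polynomial n → Polynomial n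
    f x y = x :↑ 2 :+ :cast 3 :* y :↑ 2
    g x y = x :↑ 3 :- :cast 9 :* x :* y :↑ 2

theorem1p1 : ∀ {c ℓ} (K : AlgClosedFieldChar0 c ℓ) → let open Forms K in
    MinDistBound 2 (W2 2) φ4 2 4 8
    × MinDistBound 2 WH8 W12 4 12 24
    × MinDistBound 3 W4 ψ6 3 6 12
    × MinDistBound 4 (W2 4) φ3 2 3 6
theorem1p1 K = typeI , typeII , typeIII , typeIV
  where open FourTypes K
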